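{- There exists a constant $0<c<1$ such that the following holds for all $\delta,\varepsilon>0$, $0<s\le w$ and $$p\le p(w,s):=\frac{c\,\delta^{s/2w}}{(w^3\log(1/\varepsilon))^2}.$$ For any width-$w$ DNF formula $f:\{0,1\}^n\to\{0,1\}$ and $\rho\leftarrow\mathcal D$ with $\mathcal D\in\mathcal D_p(w)$, with probability at least $1-\delta^{s/4}-\varepsilon$ there exist width-$w/2$ DNF formulae $f_\rho^\ell,f_\rho^u:\{0,1\}^{L(\rho)}\to\{0,1\}$ that are $\varepsilon$-sandwiching approximators for $f_\rho$.
   Context: A DNF formula is an OR of terms, each term being an AND of literals; it has width $v$ if every term has at most $v$ literals. Functions $g_\ell,g_u$ are $\varepsilon$-sandwiching approximators for a Boolean function $g$ if $g_\ell\le g\le g_u$ pointwise and each of $g_\ell,g_u$ differs from $g$ with probability at most $\varepsilon$ on a uniformly random input. Restrictions: for $L\subseteq[n]$ and $x\in\{0,1\}^{[n]\setminus L}$, the restriction $\rho=\rho_{L,x}\in\{*,0,1\}^n$ has $\rho_i=*$ if $i\in L$ and $\rho_i=x_i$ otherwise; $L(\rho)=L$ is the set of live variables. For $f:\{0,1\}^n\to\{0,1\}$, the function $f_\rho:\{0,1\}^{L(\rho)}\to\{0,1\}$ is $f_\rho(y)=f(z)$ with $z_i=y_i$ for $i\in L(\rho)$ and $z_i=\rho_i$ otherwise. For a distribution $\mathcal D$ on $2^{[n]}$ (the subsets of $[n]$), $\rho\leftarrow\mathcal D$ means $\rho=\rho_{L,x}$ with $L\leftarrow\mathcal D$ and $x$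 uniform in $\{0,1\}^{[n]\setminus L}$. $\mathcal D$ is $p$-regular if $\Pr_{L\leftarrow\mathcal D}[i\in L]=p$ for each $i\in[n]$. For $k\le n$, $\mathcal D_p(k)$ denotes the class of $p$-regular distributions $\mathcal D$ on $2^{[n]}$ such that $\Pr_{L\leftarrow\mathcal D}[I\subseteq L]\le 2p^{|I|}$ for all $I\subseteq[n]$ with $|I|\le k$.
   Formalization: The formal theorem assumes ε ≤ 1/2 (so log(1/ε) ≥ 1, base 2); as stated for all ε > 0 the claim fails for ε close to 1, e.g. w = s = 2, all variables live, p = 1, f an OR of many disjoint two-variable ANDs, and for ε ≥ 1 it is trivial. -}

module Defs where

open import Level using (0ℓ)
open import Algebra.Bundles using (CommutativeRing; Semiring)
open import Algebra.Structures using (IsCommutativeRing)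
import Algebra.Definitions.RawSemiring as RawSemiringDefs
open import Data.Bool.Base as Bool using (Bool; true; false; not; if_then_else_; T; _xor_)
open import Data.Bool.ListAction using (any; all)
open import Data.Fin.Base using (Fin)
open import Data.Fin.Subset using (Subset; inside; outside; _∈_; _⊆_; ∁; ∣_∣)
open import Data.Fin.Subset.Properties using (_∈?_; _⊆?_)
open import Data.List.Base as List using (List; foldr; length; filterᵇ; _++_)
open import Data.List.Relation.Unary.All using (All)
open import Data.Nat.Base as ℕ using (ℕ; zero; suc)
open import Data.Product.Base using (Σ; ∃; _×_; _,_; Σ-syntax)
open import Data.Vec.Base as Vec using (Vec; []; _∷_; lookup; here; there)
open import Relation.Binary.Core using (Rel)
open import Relation.Binary.Structures using (IsDecTotalOrder)
import Relation.Binary.Construct.NonStrictToStrict as ToStrict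
open import Relation.Nullary using (¬_; does)

-- The standard library has no real numbers, so they are axiomatised, with
-- classical order, as a Dedekind-complete ordered field; this determines
-- them up to unique isomorphism.  The functions 2^ and log are determined
-- too: 2^ is the only monotone map turning sums into products and sending
-- 1 to 2, and log is its inverse on the positive reals.  Like x ⁻¹ at 0,
-- log x is an arbitrary value for x not positive.
record Reals : Set₁ where
  infix  4 _≈_ _≤_
  infixl 6 _+_ _-_
  infixl 7 _*_ _/_
  infix  8 -_ _⁻¹
  infixr 8 _**_
  field
    ℝ       : Set
    _≈_ _≤_ : Rel ℝ 0ℓ
    _+_ _*_ : ℝ → ℝ → ℝ
    -_ _⁻¹  : ℝ → ℝ
    0# 1#   : ℝ
    2^ log  : ℝ → ℝ

    isCommutativeRing : IsCommutativeRing _≈_ _+_ _*_ -_ 0# 1#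
    isDecTotalOrder   : IsDecTotalOrder _≈_ _≤_

  open ToStrict _≈_ _≤_ public using (_<_)

  field
    0<1        : 0# < 1#
    +-monoʳ-≤  : ∀ x {y z} → y ≤ z → x + y ≤ x + z
    *-nonneg   : ∀ {x y} → 0# ≤ x → 0# ≤ y → 0# ≤ x * y
    ⁻¹-cong    : ∀ {x y} → x ≈ y → x ⁻¹ ≈ y ⁻¹
    ⁻¹-inverse : ∀ {x} → ¬ (x ≈ 0#) → x * x ⁻¹ ≈ 1#

    supremum : (P : ℝ → Set) → ∃ P → (∃ λ b → ∀ x → P x → x ≤ b) →
               ∃ λ s → (∀ x → P x → x ≤ s) ×
                       (∀ b → (∀ x → P x → x ≤ b) → s ≤ b)

    2^-mono-≤ : ∀ {x y} → x ≤ y → 2^ x ≤ 2^ y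
    2^-+      : ∀ x y → 2^ (x + y) ≈ 2^ x * 2^ y
    2^-1      : 2^ 1# ≈ 1# + 1#
    log-cong  : ∀ {x y} → x ≈ y → log x ≈ log y
    2^-log    : ∀ {x} → 0# < x → 2^ (log x) ≈ x

  commutativeRing : CommutativeRing 0ℓ 0ℓ
  commutativeRing = record { isCommutativeRing = isCommutativeRing }

  open RawSemiringDefs (Semiring.rawSemiring (CommutativeRing.semiring commutativeRing)) public
    using (_^_) renaming (_×_ to _·_)

  fromℕ : ℕ → ℝ
  fromℕ n = n · 1#

  _-_ _/_ : ℝ → ℝ → ℝ
  x - y = x + (- y)
  x / y = x * y ⁻¹

  -- x raised to a real power; meaningful for a positive base only.
  _**_ : ℝ → ℝ → ℝ
  x ** y = 2^ (y * log x)

  sumOver : {A : Set} → List A → (A → ℝ) → ℝ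
  sumOver xs f = foldr (λ a r → f a + r) 0# xs

-- Cube L is {0,1}^L: one bit for every element of L.
data Cube : ∀ {n} → Subset n → Set where
  []   : Cube []
  _∷_  : ∀ {n} {L : Subset n} → Bool → Cube L → Cube (inside ∷ L)
  skip : ∀ {n} {L : Subset n} → Cube L → Cube (outside ∷ L)

Elem : ∀ {n} → Subset n → Set
Elem {n} L = Σ[ i ∈ Fin n ] i ∈ L

coord : ∀ {n} {L : Subset n} → Cube L → Elem L → Bool
coord (b ∷ y)  (_ , here)      = b
coord (_ ∷ y)  (_ , there i∈L) = coord y (_ , i∈L)
coord (skip y) (_ , there i∈L) = coord y (_ , i∈L)

points : ∀ {n} (L : Subset n) → List (Cube L)
points []            = [] List.∷ List.[]
points (inside  ∷ L) = List.map (false ∷_) (points L) ++ List.map (true ∷_) (points L)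
points (outside ∷ L) = List.map skip (points L)

subsets : ∀ n → List (Subset n)
subsets zero    = [] List.∷ List.[]
subsets (suc n) = List.map (outside ∷_) (subsets n) ++ List.map (inside ∷_) (subsets n)

-- The point z with z_i = y_i for i in L and z_i = x_i otherwise.
merge : ∀ {n} {L : Subset n} → Cube (∁ L) → Cube L → Vec Bool n
merge {L = []}          []       []       = []
merge {L = inside  ∷ L} (skip x) (b ∷ y)  = b ∷ merge x y
merge {L = outside ∷ L} (b ∷ x)  (skip y) = b ∷ merge x y

data Literal (V : Set) : Set where
  pos neg : V → Literal V

Term DNF : Set → Set
Term V = List (Literal V)
DNF  V = List (Term V)

module _ {V : Set} (a : V → Bool) where

  evalLiteral : Literal V → Bool
  evalLiteral (pos v) = a v
  evalLiteral (neg v) = not (a v)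

  evalTerm : Term V → Bool
  evalTerm = all evalLiteral

  evalDNF : DNF V → Bool
  evalDNF = any evalTerm

HasWidth : {V : Set} → ℕ → DNF V → Set
HasWidth v = All (λ t → length t ℕ.≤ v)

⟦_⟧ : ∀ {n} → DNF (Fin n) → Vec Bool n → Bool
⟦ f ⟧ z = evalDNF (lookup z) f

⟦_⟧ᴸ : ∀ {n} {L : Subset n} → DNF (Elem L) → Cube L → Bool
⟦ f ⟧ᴸ y = evalDNF (coord y) f

record Restriction (n : ℕ) : Set where
  constructor ρ[_,_]
  field
    live  : Subset n
    fixed : Cube (∁ live)

open Restriction public

_↾_ : ∀ {n} → (Vec Bool n → Bool) → (ρ : Restriction n) → Cube (live ρ) → Bool
(f ↾ ρ) y = f (merge (fixed ρ) y)

module Probability (R : Reals) where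
  open Reals R

  Pr-uniform : ∀ {n} {L : Subset n} → (Cube L → Bool) → ℝ
  Pr-uniform {L = L} E =
    fromℕ (length (filterᵇ E (points L))) / fromℕ (length (points L))

  record IsSandwich {n} {L : Subset n} (ε : ℝ) (gℓ g gᵤ : Cube L → Bool) : Set where
    field
      lower       : ∀ y → gℓ y Bool.≤ g y
      upper       : ∀ y → g y Bool.≤ gᵤ y
      lower-error : Pr-uniform (λ y → gℓ y xor g y) ≤ ε
      upper-error : Pr-uniform (λ y → gᵤ y xor g y) ≤ ε

  record Distribution (n : ℕ) : Set where
    field
      weight    : Subset n → ℝ
      weight-≥0 : ∀ L → 0# ≤ weight L
      weight-∑1 : sumOver (subsets n) weight ≈ 1#

  open Distribution public

  Pr-subset : ∀ {n} → Distribution n → (Subset n → Bool) → ℝ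
  Pr-subset {n} D E = sumOver (subsets n) (λ L → if E L then weight D L else 0#)

  Regular : ∀ {n} → ℝ → Distribution n → Set
  Regular p D = ∀ i → Pr-subset D (λ L → does (i ∈? L)) ≈ p

  -- Membership of D in the class 𝒟_p(k).
  record InClass {n} (p : ℝ) (k : ℕ) (D : Distribution n) : Set where
    field
      regular : Regular p D
      bounded : ∀ I → ∣ I ∣ ℕ.≤ k →
                Pr-subset D (λ L → does (I ⊆? L)) ≤ fromℕ 2 * p ^ ∣ I ∣

  -- Probability of an event under ρ ← D: the live set is drawn from D and
  -- the remaining coordinates are then fixed uniformly.
  Pr-restriction : ∀ {n} → Distribution n → (Restriction n → Bool) → ℝ
  Pr-restriction {n} D E =
    sumOver (subsets n) (λ L → weight D L * Pr-uniform (λ x → E ρ[ L , x ]))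

  -- An event given as a predicate, with no decision procedure attached, has
  -- probability at least q when it contains a Boolean-valued event that does.
  WithProbability≥ : ∀ {n} → ℝ → Distribution n → (Restriction n → Set) → Set
  WithProbability≥ {n} q D E =
    Σ[ G ∈ (Restriction n → Bool) ]
      (∀ ρ → T (G ρ) → E ρ) × q ≤ Pr-restriction D G

  -- c δ^(s/2w) / (w³ log(1/ε))²
  threshold : (c δ ε s : ℝ) → ℕ → ℝ
  threshold c δ ε s w =
    c * δ ** (s / (fromℕ 2 * fromℕ w)) /
    (fromℕ w ^ 3 * log (1# / ε)) ^ 2

{-# OPTIONS --safe #-}

-- A quasi-sunflower is a family of terms Y containing a core K such that a
-- random point satisfying K satisfies some Y except with probability 2^-r.
-- A family of width j that is R-spread over K, with R ≥ 6rj, is one: fixing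
-- all coordinates at random is no worse than r independent attempts that fix
-- each coordinate with probability 1/r only (induction on the coordinates with
-- Bernoulli's inequality), and by Chebyshev's inequality a single attempt
-- succeeds with probability at least 1/2.
--
-- Start from the terms of f, each one a core with itself as its only member.
-- As long as more than R^j cores have the same size j, a largest K contained in
-- more than R^(j - |K|) of them has a spread family over it, so R^(j - |K|) of
-- these cores are merged into the new core K, pooling their members, and all
-- cores of size j containing K are dropped.  At the end the cores form an upper
-- and the members a lower approximator of f, both with at most (w+1)R^w terms,
-- and the union bound over the cores controls the gap between them.
--
-- For ε ≥ 2^-m take r = 16w²m and R = 6rw, which makes the gap at most 2^-2m; by
-- Markov's inequality it exceeds 2^-m after the restriction with probability at
-- most 2^-m.  A term keeps more than w/2 live variables only if some set of
-- ⌊w/2⌋ + 1 of its variables is live; the union bound over these sets costs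
-- at most (16R)^w p^(⌊w/2⌋ + 1).
module Submission where

open import Algebra.Bundles using (CommutativeRing)
import Algebra.Properties.CommutativeSemiring.Exp
import Algebra.Properties.Semiring.Mult
import Algebra.Solver.Ring.NaturalCoefficients.Default
open import Data.Bool.Base as Bool using (Bool; true; false; not; _∧_; _∨_; _xor_; if_then_else_; T)
open import Data.Bool.ListAction using (any)
open import Data.Bool.Properties using (T?; ∧-zeroʳ)
open import Data.Empty using (⊥-elim)
open import Data.Fin.Base as Fin using (Fin; zero; suc)
open import Data.Fin.Subset using (Subset; inside; outside; ∁; ∣_∣; _⊆_)
open import Data.Fin.Subset.Properties using (_⊆?_; out⊆; s⊆s)
open import Data.List.Base as List using (List; []; _∷_; length; map; filterᵇ; _++_; concatMap; take; mapMaybe)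
open import Data.List.Membership.Propositional using (_∈_)
open import Data.List.Membership.Propositional.Properties using (∈-++⁺ˡ; ∈-++⁺ʳ; ∈-map⁺)
open import Data.List.Properties using (length-++; length-map; length-take)
open import Data.List.Relation.Unary.All as All using (All; []; _∷_)
open import Data.List.Relation.Unary.All.Properties as All using (all-filter; filter⁺; take⁺; map⁺; concat⁺)
open import Data.List.Relation.Unary.Any using (here; there)
open import Data.Maybe.Base as Maybe using (Maybe; just; nothing)
open import Data.Nat.Base as ℕ using (ℕ; zero; suc; ⌊_/2⌋; NonZero; s≤s; z≤n)
import Data.Nat.Properties as ℕ
open import Data.Nat.Tactic.RingSolver using (solve-∀)
open import Data.Product.Base using (Σ-syntax; ∃-syntax; _×_; _,_; proj₁; proj₂)
open import Data.Sum.Base using (_⊎_; inj₁; inj₂)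
open import Data.Unit.Base using (tt)
open import Data.Vec.Base as Vec using (Vec; []; _∷_; lookup; here; there)
open import Function.Base using (_∘_; const)
open import Relation.Binary.Bundles using (Poset)
import Relation.Binary.PropositionalEquality as ≡
open ≡ using (_≡_; subst; cong; cong₂)
import Relation.Binary.Reasoning.PartialOrder
open import Relation.Binary.Structures using (IsDecTotalOrder)
open import Relation.Nullary using (¬_; Dec; yes; no; does)
open import Relation.Nullary.Decidable using (dec-true)

open import Defs

module Counting where

  open import Data.Nat.Base
  open import Data.Nat.Properties
  open ≡ using (refl; sym; trans; module ≡-Reasoning)

  private variable
    α β : Set
    n : ℕ

  ∑ : List α → (α → ℕ) → ℕ
  ∑ []       f = 0
  ∑ (x ∷ xs) f = f x + ∑ xs f

  ∑-mono-All : {f g : α → ℕ} {xs : List α} → All (λ x → f x ≤ g x) xs → ∑ xs f ≤ ∑ xs g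
  ∑-mono-All []       = z≤n
  ∑-mono-All (p ∷ ps) = +-mono-≤ p (∑-mono-All ps)

  ∑-mono : (xs : List α) {f g : α → ℕ} → (∀ x → f x ≤ g x) → ∑ xs f ≤ ∑ xs g
  ∑-mono xs h = ∑-mono-All (All.universal h xs)

  ∑-cong : (xs : List α) {f g : α → ℕ} → (∀ x → f x ≡ g x) → ∑ xs f ≡ ∑ xs g
  ∑-cong []       h = refl
  ∑-cong (x ∷ xs) h = cong₂ _+_ (h x) (∑-cong xs h)

  ∑-+ : (xs : List α) (f g : α → ℕ) → ∑ xs (λ x → f x + g x) ≡ ∑ xs f + ∑ xs g
  ∑-+ []       f g = refl
  ∑-+ (x ∷ xs) f g = trans (cong (f x + g x +_) (∑-+ xs f g)) (lem (f x) (g x) _ _)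
    where
    lem : ∀ a b c d → a + b + (c + d) ≡ a + c + (b + d)
    lem = solve-∀

  ∑-*ˡ : (xs : List α) (c : ℕ) (f : α → ℕ) → ∑ xs (λ x → c * f x) ≡ c * ∑ xs f
  ∑-*ˡ []       c f = sym (*-zeroʳ c)
  ∑-*ˡ (x ∷ xs) c f = trans (cong (c * f x +_) (∑-*ˡ xs c f)) (sym (*-distribˡ-+ c (f x) _))

  ∑-*ʳ : (xs : List α) (c : ℕ) (f : α → ℕ) → ∑ xs (λ x → f x * c) ≡ ∑ xs f * c
  ∑-*ʳ xs c f = trans (∑-cong xs λ x → *-comm (f x) c) (trans (∑-*ˡ xs c f) (*-comm c _))

  ∑-const : (xs : List α) (c : ℕ) → ∑ xs (const c) ≡ length xs * c
  ∑-const []       c = refl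
  ∑-const (x ∷ xs) c = cong (c +_) (∑-const xs c)

  ∑-≤-const : {xs : List α} {f : α → ℕ} {c : ℕ} → All (λ x → f x ≤ c) xs → ∑ xs f ≤ length xs * c
  ∑-≤-const {xs = xs} {c = c} ps = ≤-trans (∑-mono-All ps) (≤-reflexive (∑-const xs c))

  ∑-++ : (xs ys : List α) (f : α → ℕ) → ∑ (xs ++ ys) f ≡ ∑ xs f + ∑ ys f
  ∑-++ []       ys f = refl
  ∑-++ (x ∷ xs) ys f = trans (cong (f x +_) (∑-++ xs ys f)) (sym (+-assoc (f x) _ _))

  ∑-map : (h : α → β) (xs : List α) (f : β → ℕ) → ∑ (map h xs) f ≡ ∑ xs (f ∘ h)
  ∑-map h []       f = refl
  ∑-map h (x ∷ xs) f = cong (f (h x) +_) (∑-map h xs f)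

  ind : Bool → ℕ
  ind b = if b then 1 else 0

  ind≤1 : ∀ b → ind b ≤ 1
  ind≤1 true  = ≤-refl
  ind≤1 false = z≤n

  length-filterᵇ : (p : α → Bool) (xs : List α) → length (filterᵇ p xs) ≡ ∑ xs (ind ∘ p)
  length-filterᵇ p []       = refl
  length-filterᵇ p (x ∷ xs) with p x
  ... | true  = cong suc (length-filterᵇ p xs)
  ... | false = length-filterᵇ p xs

  ^-distribʳ-* : ∀ a b k → (a * b) ^ k ≡ a ^ k * b ^ k
  ^-distribʳ-* a b zero    = refl
  ^-distribʳ-* a b (suc k) = trans (cong (a * b *_) (^-distribʳ-* a b k)) (lem a b (a ^ k) (b ^ k))
    where
    lem : ∀ a b c d → a * b * (c * d) ≡ a * c * (b * d)
    lem = solve-∀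

  -- Bernoulli's inequality, homogenised so that no subtraction occurs.
  bernoulli : ∀ x d a → (x + d) ^ suc a ≤ x ^ suc a + suc a * d * (x + d) ^ a
  bernoulli x d zero    = ≤-reflexive (lem x d)
    where
    lem : ∀ x d → (x + d) * 1 ≡ x * 1 + (d + 0) * 1
    lem = solve-∀
  bernoulli x d (suc a) = begin
    (x + d) * y                                ≡⟨ *-distribʳ-+ y x d ⟩
    x * y + d * y                              ≤⟨ +-monoˡ-≤ (d * y) (*-monoʳ-≤ x (bernoulli x d a)) ⟩
    x * (z + suc a * d * t) + d * y            ≤⟨ +-monoˡ-≤ (d * y) (≤-reflexive (lem₁ x z (suc a) d t)) ⟩
    x * z + suc a * d * (x * t) + d * y        ≤⟨ +-monoˡ-≤ (d * y) (+-monoʳ-≤ (x * z) (*-monoʳ-≤ (suc a * d) (*-monoˡ-≤ t (m≤m+n x d)))) ⟩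
    x * z + suc a * d * y + d * y              ≡⟨ lem₂ (x * z) (suc a) d y ⟩
    x * z + suc (suc a) * d * y                ∎
    where
    open ≤-Reasoning
    y = (x + d) ^ suc a
    z = x ^ suc a
    t = (x + d) ^ a
    lem₁ : ∀ x z s d t → x * (z + s * d * t) ≡ x * z + s * d * (x * t)
    lem₁ = solve-∀
    lem₂ : ∀ p s d y → p + s * d * y + d * y ≡ p + (d + s * d) * y
    lem₂ = solve-∀

  power-convexity : ∀ a s d₀ d₁ s₀ s₁ → s₀ + d₀ ≡ s → s₁ + d₁ ≡ s → let r = suc a in
                    (2 * r) ^ r * (s₀ ^ r + s₁ ^ r) ≤ 2 * (2 * a * s + (s₀ + s₁)) ^ r
  power-convexity a s d₀ d₁ s₀ s₁ refl e₁ = +-cancelʳ-≤ (2 * (r * d * N ^ a)) _ _ (begin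
    (2 * r) ^ r * (s₀ ^ r + s₁ ^ r) + 2 * (r * d * N ^ a)
      ≤⟨ +-monoˡ-≤ _ (*-monoʳ-≤ ((2 * r) ^ r) (+-mono-≤
           (*-monoʳ-≤ s₀ (^-monoˡ-≤ a (m≤m+n s₀ d₀)))
           (*-monoʳ-≤ s₁ (^-monoˡ-≤ a (≤-trans (m≤m+n s₁ d₁) (≤-reflexive e₁)))))) ⟩
    (2 * r) ^ r * (s₀ * s ^ a + s₁ * s ^ a) + 2 * (r * d * N ^ a)
      ≡⟨ cong (λ t → (2 * r) ^ r * (s₀ * s ^ a + s₁ * s ^ a) + 2 * (r * d * t)) (^-distribʳ-* (2 * r) s a) ⟩
    (2 * r) ^ r * (s₀ * s ^ a + s₁ * s ^ a) + 2 * (r * d * ((2 * r) ^ a * s ^ a))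
      ≡⟨ lem₁ r ((2 * r) ^ a) s₀ s₁ d₀ d₁ (s ^ a) ⟩
    2 * r * (2 * r) ^ a * s ^ a * ((s₀ + d₀) + (s₁ + d₁))
      ≡⟨ cong (λ t → 2 * r * (2 * r) ^ a * s ^ a * (s + t)) e₁ ⟩
    2 * r * (2 * r) ^ a * s ^ a * (s + s)
      ≡⟨ lem₂ r s ((2 * r) ^ a) (s ^ a) ⟩
    2 * (N * ((2 * r) ^ a * s ^ a))
      ≡⟨ cong (λ t → 2 * (N * t)) (sym (^-distribʳ-* (2 * r) s a)) ⟩
    2 * N ^ r
      ≡⟨ cong (λ t → 2 * t ^ r) (sym x+d≡N) ⟩
    2 * (x + d) ^ r
      ≤⟨ *-monoʳ-≤ 2 (bernoulli x d a) ⟩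
    2 * (x ^ r + r * d * (x + d) ^ a)
      ≡⟨ *-distribˡ-+ 2 (x ^ r) _ ⟩
    2 * x ^ r + 2 * (r * d * (x + d) ^ a)
      ≡⟨ cong (λ t → 2 * x ^ r + 2 * (r * d * t ^ a)) x+d≡N ⟩
    2 * x ^ r + 2 * (r * d * N ^ a) ∎)
    where
    open ≤-Reasoning
    r = suc a
    N = 2 * r * s
    d = d₀ + d₁
    x = 2 * a * s + (s₀ + s₁)
    lem₀ : ∀ a s s₀ s₁ d₀ d₁ → 2 * a * s + (s₀ + s₁) + (d₀ + d₁) ≡ 2 * a * s + ((s₀ + d₀) + (s₁ + d₁))
    lem₀ = solve-∀
    lem₀′ : ∀ a s → 2 * a * s + (s + s) ≡ 2 * (1 + a) * s
    lem₀′ = solve-∀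
    x+d≡N : x + d ≡ N
    x+d≡N = trans (lem₀ a s s₀ s₁ d₀ d₁) (trans (cong (λ t → 2 * a * s + (s + t)) e₁) (lem₀′ a s))
    lem₁ : ∀ r q s₀ s₁ d₀ d₁ t →
           2 * r * q * (s₀ * t + s₁ * t) + 2 * (r * (d₀ + d₁) * (q * t)) ≡
           2 * r * q * t * ((s₀ + d₀) + (s₁ + d₁))
    lem₁ = solve-∀
    lem₂ : ∀ r s q t → 2 * r * q * t * (s + s) ≡ 2 * (2 * r * s * (q * t))
    lem₂ = solve-∀

  Partial : ℕ → Set
  Partial = Vec (Maybe Bool)

  size : Partial n → ℕ
  size []            = 0
  size (nothing ∷ K) = size K
  size (just _  ∷ K) = suc (size K)

  same : Bool → Bool → Bool
  same true  c = c
  same false c = not c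

  same-refl : ∀ b → T (same b b)
  same-refl true  = tt
  same-refl false = tt

  same-≡ : ∀ b c → T (same b c) → b ≡ c
  same-≡ true  true  _ = refl
  same-≡ false false _ = refl

  infix 4 _⊑_
  _⊑_ : Partial n → Partial n → Bool
  []            ⊑ []            = true
  (nothing ∷ Y) ⊑ (_ ∷ H)       = Y ⊑ H
  (just b ∷ Y)  ⊑ (nothing ∷ H) = false
  (just b ∷ Y)  ⊑ (just c ∷ H)  = same b c ∧ (Y ⊑ H)

  T-∧⁺ : ∀ {a b} → T a → T b → T (a ∧ b)
  T-∧⁺ {true} _ q = q

  T-∧⁻ : ∀ {a b} → T (a ∧ b) → T a × T b
  T-∧⁻ {true} q = tt , q

  ⊑-refl : (Y : Partial n) → T (Y ⊑ Y)
  ⊑-refl []            = tt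
  ⊑-refl (nothing ∷ Y) = ⊑-refl Y
  ⊑-refl (just b ∷ Y)  = T-∧⁺ (same-refl b) (⊑-refl Y)

  ⊑-trans : (X Y Z : Partial n) → T (X ⊑ Y) → T (Y ⊑ Z) → T (X ⊑ Z)
  ⊑-trans []            []            []            p q = tt
  ⊑-trans (nothing ∷ X) (nothing ∷ Y) (_ ∷ Z)       p q = ⊑-trans X Y Z p q
  ⊑-trans (nothing ∷ X) (just _ ∷ Y)  (just _ ∷ Z)  p q = ⊑-trans X Y Z p (proj₂ (T-∧⁻ q))
  ⊑-trans (just a ∷ X)  (just b ∷ Y)  (just c ∷ Z)  p q
    with refl ← same-≡ a b (proj₁ (T-∧⁻ p)) | refl ← same-≡ b c (proj₁ (T-∧⁻ q))
    = T-∧⁺ (same-refl a) (⊑-trans X Y Z (proj₂ (T-∧⁻ p)) (proj₂ (T-∧⁻ q)))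

  ⊑⇒size≤ : (X Y : Partial n) → T (X ⊑ Y) → size X ≤ size Y
  ⊑⇒size≤ []            []            p = z≤n
  ⊑⇒size≤ (nothing ∷ X) (nothing ∷ Y) p = ⊑⇒size≤ X Y p
  ⊑⇒size≤ (nothing ∷ X) (just _ ∷ Y)  p = m≤n⇒m≤1+n (⊑⇒size≤ X Y p)
  ⊑⇒size≤ (just _ ∷ X)  (just _ ∷ Y)  p = s≤s (⊑⇒size≤ X Y (proj₂ (T-∧⁻ p)))

  ⊑∧size≥⇒≡ : (X Y : Partial n) → T (X ⊑ Y) → size Y ≤ size X → X ≡ Y
  ⊑∧size≥⇒≡ []            []            p q = refl
  ⊑∧size≥⇒≡ (nothing ∷ X) (nothing ∷ Y) p q = cong (nothing ∷_) (⊑∧size≥⇒≡ X Y p q)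
  ⊑∧size≥⇒≡ (nothing ∷ X) (just _ ∷ Y)  p q = ⊥-elim (<-irrefl refl (≤-trans q (⊑⇒size≤ X Y p)))
  ⊑∧size≥⇒≡ (just a ∷ X)  (just b ∷ Y)  p q =
    cong₂ (λ c Z → just c ∷ Z) (same-≡ a b (proj₁ (T-∧⁻ p))) (⊑∧size≥⇒≡ X Y (proj₂ (T-∧⁻ p)) (s≤s⁻¹ q))

  -- Sum of g over the partial assignments that extend K; each coordinate left
  -- unset contributes the weight u.  For u = 0 only total assignments count.
  sumAbove : ℕ → Partial n → (Partial n → ℕ) → ℕ
  sumAbove u []            g = g []
  sumAbove u (just b ∷ K)  g = sumAbove u K (g ∘ (just b ∷_))
  sumAbove u (nothing ∷ K) g =
    u * sumAbove u K (g ∘ (nothing ∷_)) +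
    (sumAbove u K (g ∘ (just false ∷_)) + sumAbove u K (g ∘ (just true ∷_)))

  module _ (u : ℕ) where

    sumAbove-mono : (K : Partial n) {f g : Partial n → ℕ} → (∀ H → f H ≤ g H) →
                    sumAbove u K f ≤ sumAbove u K g
    sumAbove-mono []            h = h []
    sumAbove-mono (just b ∷ K)  h = sumAbove-mono K (h ∘ (just b ∷_))
    sumAbove-mono (nothing ∷ K) h =
      +-mono-≤ (*-monoʳ-≤ u (sumAbove-mono K (h ∘ (nothing ∷_))))
        (+-mono-≤ (sumAbove-mono K (h ∘ (just false ∷_))) (sumAbove-mono K (h ∘ (just true ∷_))))

    sumAbove-cong : (K : Partial n) {f g : Partial n → ℕ} → (∀ H → f H ≡ g H) →
                    sumAbove u K f ≡ sumAbove u K g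
    sumAbove-cong K h = ≤-antisym (sumAbove-mono K (≤-reflexive ∘ h)) (sumAbove-mono K (≤-reflexive ∘ sym ∘ h))

    sumAbove-+ : (K : Partial n) (f g : Partial n → ℕ) →
                 sumAbove u K (λ H → f H + g H) ≡ sumAbove u K f + sumAbove u K g
    sumAbove-+ []            f g = refl
    sumAbove-+ (just b ∷ K)  f g = sumAbove-+ K _ _
    sumAbove-+ (nothing ∷ K) f g
      rewrite sumAbove-+ K (f ∘ (nothing ∷_)) (g ∘ (nothing ∷_))
            | sumAbove-+ K (f ∘ (just false ∷_)) (g ∘ (just false ∷_))
            | sumAbove-+ K (f ∘ (just true ∷_)) (g ∘ (just true ∷_)) = lem u _ (sumAbove u K (g ∘ (nothing ∷_))) (sumAbove u K (f ∘ (just false ∷_))) _ (sumAbove u K (f ∘ (just true ∷_))) _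
      where
      lem : ∀ u a b c d e f → u * (a + b) + (c + d + (e + f)) ≡ u * a + (c + e) + (u * b + (d + f))
      lem = solve-∀

    sumAbove-* : (K : Partial n) (c : ℕ) (f : Partial n → ℕ) →
                 sumAbove u K (λ H → c * f H) ≡ c * sumAbove u K f
    sumAbove-* []            c f = refl
    sumAbove-* (just b ∷ K)  c f = sumAbove-* K c _
    sumAbove-* (nothing ∷ K) c f
      rewrite sumAbove-* K c (f ∘ (nothing ∷_))
            | sumAbove-* K c (f ∘ (just false ∷_))
            | sumAbove-* K c (f ∘ (just true ∷_)) = lem u c _ _ _
      where
      lem : ∀ u c x y z → u * (c * x) + (c * y + c * z) ≡ c * (u * x + (y + z))
      lem = solve-∀

    sumAbove-0 : (K : Partial n) {g : Partial n → ℕ} → (∀ H → g H ≡ 0) → sumAbove u K g ≡ 0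
    sumAbove-0 K h = trans (sumAbove-cong K h) (sumAbove-* K 0 (const 0))

    sumAbove-∑ : (K : Partial n) (xs : List α) (f : α → Partial n → ℕ) →
                 sumAbove u K (λ H → ∑ xs (λ x → f x H)) ≡ ∑ xs (λ x → sumAbove u K (f x))
    sumAbove-∑ K []       f = sumAbove-0 K λ _ → refl
    sumAbove-∑ K (x ∷ xs) f = trans (sumAbove-+ K (f x) _) (cong (sumAbove u K (f x) +_) (sumAbove-∑ K xs f))

    mass : Partial n → ℕ
    mass K = sumAbove u K (const 1)

    mass-nothing : (K : Partial n) → mass (nothing ∷ K) ≡ (u + 2) * mass K
    mass-nothing K = lem u (mass K)
      where
      lem : ∀ u x → u * x + (x + x) ≡ (u + 2) * x
      lem = solve-∀

    sumAbove-const : (K : Partial n) (c : ℕ) → sumAbove u K (const c) ≡ c * mass K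
    sumAbove-const K c = trans (sumAbove-cong K λ _ → sym (*-identityʳ c)) (sumAbove-* K c (const 1))

    sumAbove-⊑ : (K Y : Partial n) → T (K ⊑ Y) → (g : Partial n → ℕ) →
                 sumAbove u K (λ H → ind (Y ⊑ H) * g H) ≡ sumAbove u Y g
    sumAbove-⊑ []            []            p g = +-identityʳ (g [])
    sumAbove-⊑ (just true ∷ K)  (just true ∷ Y)  p g = sumAbove-⊑ K Y p _
    sumAbove-⊑ (just false ∷ K) (just false ∷ Y) p g = sumAbove-⊑ K Y p _
    sumAbove-⊑ (nothing ∷ K) (nothing ∷ Y) p g
      rewrite sumAbove-⊑ K Y p (g ∘ (nothing ∷_))
            | sumAbove-⊑ K Y p (g ∘ (just false ∷_))
            | sumAbove-⊑ K Y p (g ∘ (just true ∷_)) = refl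
    sumAbove-⊑ (nothing ∷ K) (just true ∷ Y) p g
      rewrite sumAbove-0 K {λ _ → 0} (λ _ → refl) | *-zeroʳ u = sumAbove-⊑ K Y p _
    sumAbove-⊑ (nothing ∷ K) (just false ∷ Y) p g
      rewrite sumAbove-0 K {λ _ → 0} (λ _ → refl) | *-zeroʳ u = trans (+-identityʳ _) (sumAbove-⊑ K Y p _)

    sumAbove-ind : (K Y : Partial n) → T (K ⊑ Y) → sumAbove u K (λ H → ind (Y ⊑ H)) ≡ mass Y
    sumAbove-ind K Y p = trans (sumAbove-cong K λ H → sym (*-identityʳ (ind (Y ⊑ H)))) (sumAbove-⊑ K Y p (const 1))

    mass-⊑ : (K Y : Partial n) → T (K ⊑ Y) → mass Y * (u + 2) ^ (size Y ∸ size K) ≡ mass K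
    mass-⊑ []            []            p = refl
    mass-⊑ (just _ ∷ K)  (just _ ∷ Y)  p = mass-⊑ K Y (proj₂ (T-∧⁻ p))
    mass-⊑ (nothing ∷ K) (nothing ∷ Y) p = begin
      mass (nothing ∷ Y) * (u + 2) ^ (size Y ∸ size K)    ≡⟨ cong (_* (u + 2) ^ (size Y ∸ size K)) (mass-nothing Y) ⟩
      (u + 2) * mass Y * (u + 2) ^ (size Y ∸ size K)      ≡⟨ *-assoc (u + 2) (mass Y) _ ⟩
      (u + 2) * (mass Y * (u + 2) ^ (size Y ∸ size K))    ≡⟨ cong ((u + 2) *_) (mass-⊑ K Y p) ⟩
      (u + 2) * mass K                                    ≡⟨ mass-nothing K ⟨
      mass (nothing ∷ K)                                  ∎
      where open ≡-Reasoning
    mass-⊑ (nothing ∷ K) (just _ ∷ Y) p = begin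
      mass Y * (u + 2) ^ (suc (size Y) ∸ size K)          ≡⟨ cong (λ d → mass Y * (u + 2) ^ d) (+-∸-assoc 1 (⊑⇒size≤ K Y p)) ⟩
      mass Y * ((u + 2) * (u + 2) ^ (size Y ∸ size K))    ≡⟨ lem (mass Y) (u + 2) _ ⟩
      (u + 2) * (mass Y * (u + 2) ^ (size Y ∸ size K))    ≡⟨ cong ((u + 2) *_) (mass-⊑ K Y p) ⟩
      (u + 2) * mass K                                    ≡⟨ mass-nothing K ⟨
      mass (nothing ∷ K)                                  ∎
      where
      open ≡-Reasoning
      lem : ∀ a b c → a * (b * c) ≡ b * (a * c)
      lem = solve-∀

    mass>0 : (K : Partial n) → 0 < mass K
    mass>0 []            = s≤s z≤n
    mass>0 (just _ ∷ K)  = mass>0 K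
    mass>0 (nothing ∷ K) = ≤-trans (mass>0 K) (≤-trans (m≤m+n _ _) (m≤n+m _ (u * mass K)))

  Antitone : (Partial n → ℕ) → Set
  Antitone φ = ∀ H H′ → T (H ⊑ H′) → φ H′ ≤ φ H

  -- Fixing every coordinate is at least as good as r = 1 + a independent
  -- attempts, each of which fixes a coordinate with probability 1/r.
  amplify : (a : ℕ) (K : Partial n) (φ : Partial n → ℕ) → Antitone φ → let r = suc a in
            sumAbove 0 K φ * mass (2 * a) K ^ r ≤ mass 0 K * sumAbove (2 * a) K φ ^ r
  amplify a [] φ anti = begin
    φ [] * 1 ^ suc a   ≡⟨ cong (φ [] *_) (^-zeroˡ (suc a)) ⟩
    φ [] * 1           ≡⟨ *-identityʳ (φ []) ⟩
    φ []               ≤⟨ x≤x^r (φ []) ⟩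
    φ [] ^ suc a       ≡⟨ +-identityʳ _ ⟨
    1 * φ [] ^ suc a   ∎
    where
    open ≤-Reasoning
    x≤x^r : ∀ x → x ≤ x ^ suc a
    x≤x^r zero    = z≤n
    x≤x^r (suc x) = m≤m*n (suc x) (suc x ^ a) {{m^n≢0 (suc x) a}}
  amplify a (just b ∷ K) φ anti =
    amplify a K (φ ∘ (just b ∷_)) λ H H′ p → anti _ _ (T-∧⁺ (same-refl b) p)
  amplify a (nothing ∷ K) φ anti = begin
    (C₀ + C₁) * mass (2 * a) (nothing ∷ K) ^ r
      ≡⟨ cong (λ t → (C₀ + C₁) * t ^ r) (mass-nothing (2 * a) K) ⟩
    (C₀ + C₁) * ((2 * a + 2) * M) ^ r
      ≡⟨ cong (λ t → (C₀ + C₁) * (t * M) ^ r) (lem₀ a) ⟩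
    (C₀ + C₁) * (2 * r * M) ^ r
      ≡⟨ cong ((C₀ + C₁) *_) (^-distribʳ-* (2 * r) M r) ⟩
    (C₀ + C₁) * ((2 * r) ^ r * M ^ r)
      ≡⟨ lem₁ C₀ C₁ ((2 * r) ^ r) (M ^ r) ⟩
    (2 * r) ^ r * (C₀ * M ^ r + C₁ * M ^ r)
      ≤⟨ *-monoʳ-≤ ((2 * r) ^ r) (+-mono-≤ (ih false) (ih true)) ⟩
    (2 * r) ^ r * (M₀ * s₀ ^ r + M₀ * s₁ ^ r)
      ≡⟨ lem₂ ((2 * r) ^ r) M₀ (s₀ ^ r) (s₁ ^ r) ⟩
    M₀ * ((2 * r) ^ r * (s₀ ^ r + s₁ ^ r))
      ≤⟨ *-monoʳ-≤ M₀ (power-convexity a s _ _ s₀ s₁ (m+[n∸m]≡n (below false)) (m+[n∸m]≡n (below true))) ⟩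
    M₀ * (2 * (2 * a * s + (s₀ + s₁)) ^ r)
      ≡⟨ lem₃ M₀ _ ⟩
    mass 0 (nothing ∷ K) * (2 * a * s + (s₀ + s₁)) ^ r ∎
    where
    open ≤-Reasoning
    r = suc a
    C₀ = sumAbove 0 K (φ ∘ (just false ∷_))
    C₁ = sumAbove 0 K (φ ∘ (just true ∷_))
    s = sumAbove (2 * a) K (φ ∘ (nothing ∷_))
    s₀ = sumAbove (2 * a) K (φ ∘ (just false ∷_))
    s₁ = sumAbove (2 * a) K (φ ∘ (just true ∷_))
    M = mass (2 * a) K
    M₀ = mass 0 K
    ih : ∀ b → sumAbove 0 K (φ ∘ (just b ∷_)) * M ^ r ≤ M₀ * sumAbove (2 * a) K (φ ∘ (just b ∷_)) ^ r
    ih b = amplify a K (φ ∘ (just b ∷_)) λ H H′ p → anti _ _ (T-∧⁺ (same-refl b) p)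
    below : ∀ b → sumAbove (2 * a) K (φ ∘ (just b ∷_)) ≤ s
    below b = sumAbove-mono (2 * a) K λ H → anti (nothing ∷ H) (just b ∷ H) (⊑-refl H)
    lem₀ : ∀ a → 2 * a + 2 ≡ 2 * (1 + a)
    lem₀ = solve-∀
    lem₁ : ∀ c d x y → (c + d) * (x * y) ≡ x * (c * y + d * y)
    lem₁ = solve-∀
    lem₂ : ∀ x m p q → x * (m * p + m * q) ≡ m * (x * (p + q))
    lem₂ = solve-∀
    lem₃ : ∀ m x → m * (2 * x) ≡ (m + m) * x
    lem₃ = solve-∀

  sumBetween : ℕ → Partial n → Partial n → (Partial n → ℕ) → ℕ
  sumBetween q []            Y             g = g Y
  sumBetween q (just b ∷ K)  (_ ∷ Y)       g = sumBetween q K Y (g ∘ (just b ∷_))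
  sumBetween q (nothing ∷ K) (nothing ∷ Y) g = sumBetween q K Y (g ∘ (nothing ∷_))
  sumBetween q (nothing ∷ K) (just b ∷ Y)  g =
    sumBetween q K Y (g ∘ (nothing ∷_)) + q * sumBetween q K Y (g ∘ (just b ∷_))

  module _ (q : ℕ) where

    sumBetween-0 : (K Y : Partial n) → sumBetween q K Y (const 0) ≡ 0
    sumBetween-0 []            []            = refl
    sumBetween-0 (just b ∷ K)  (_ ∷ Y)       = sumBetween-0 K Y
    sumBetween-0 (nothing ∷ K) (nothing ∷ Y) = sumBetween-0 K Y
    sumBetween-0 (nothing ∷ K) (just b ∷ Y)
      rewrite sumBetween-0 K Y = *-zeroʳ q

    sumBetween-+ : (K Y : Partial n) (f g : Partial n → ℕ) →
                   sumBetween q K Y (λ H → f H + g H) ≡ sumBetween q K Y f + sumBetween q K Y g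
    sumBetween-+ []            []            f g = refl
    sumBetween-+ (just b ∷ K)  (_ ∷ Y)       f g = sumBetween-+ K Y _ _
    sumBetween-+ (nothing ∷ K) (nothing ∷ Y) f g = sumBetween-+ K Y _ _
    sumBetween-+ (nothing ∷ K) (just b ∷ Y)  f g
      rewrite sumBetween-+ K Y (f ∘ (nothing ∷_)) (g ∘ (nothing ∷_))
            | sumBetween-+ K Y (f ∘ (just b ∷_)) (g ∘ (just b ∷_)) = lem q (sumBetween q K Y (f ∘ (nothing ∷_))) _ (sumBetween q K Y (f ∘ (just b ∷_))) _
      where
      lem : ∀ q a b c d → a + b + q * (c + d) ≡ a + q * c + (b + q * d)
      lem = solve-∀

    sumBetween-* : (K Y : Partial n) (c : ℕ) (f : Partial n → ℕ) →
                   sumBetween q K Y (λ H → c * f H) ≡ c * sumBetween q K Y f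
    sumBetween-* []            []            c f = refl
    sumBetween-* (just b ∷ K)  (_ ∷ Y)       c f = sumBetween-* K Y c _
    sumBetween-* (nothing ∷ K) (nothing ∷ Y) c f = sumBetween-* K Y c _
    sumBetween-* (nothing ∷ K) (just b ∷ Y)  c f
      rewrite sumBetween-* K Y c (f ∘ (nothing ∷_))
            | sumBetween-* K Y c (f ∘ (just b ∷_)) = lem q c _ _
      where
      lem : ∀ q c x y → c * x + q * (c * y) ≡ c * (x + q * y)
      lem = solve-∀

    sumBetween-∑ : (K Y : Partial n) (xs : List α) (f : α → Partial n → ℕ) →
                   sumBetween q K Y (λ H → ∑ xs (λ x → f x H)) ≡ ∑ xs (λ x → sumBetween q K Y (f x))
    sumBetween-∑ K Y []       f = sumBetween-0 K Y
    sumBetween-∑ K Y (x ∷ xs) f =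
      trans (sumBetween-+ K Y (f x) _) (cong (sumBetween q K Y (f x) +_) (sumBetween-∑ K Y xs f))

    sumBetween-spread : (R B : ℕ) (K Y : Partial n) → T (K ⊑ Y) → (g : Partial n → ℕ) →
                        (∀ I → g I * R ^ size I ≤ B) →
                        sumBetween q K Y g * R ^ size Y ≤ B * (R + q) ^ (size Y ∸ size K)
    sumBetween-spread R B []            []            p g h = ≤-trans (h []) (m≤m*n B 1)
    sumBetween-spread R B (nothing ∷ K) (nothing ∷ Y) p g h =
      sumBetween-spread R B K Y p (g ∘ (nothing ∷_)) (h ∘ (nothing ∷_))
    sumBetween-spread R B (just b ∷ K)  (just c ∷ Y)  p g h = begin
      sumBetween q K Y g₁ * (R * R ^ size Y)         ≡⟨ x*Ry≡R*x*y R (sumBetween q K Y g₁) (R ^ size Y) ⟩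
      R * sumBetween q K Y g₁ * R ^ size Y           ≡⟨ cong (_* R ^ size Y) (sumBetween-* K Y R g₁) ⟨
      sumBetween q K Y (λ I → R * g₁ I) * R ^ size Y ≤⟨ sumBetween-spread R B K Y (proj₂ (T-∧⁻ p)) (λ I → R * g₁ I)
                                                          (λ I → ≤-trans (≤-reflexive (sym (x*Ry≡R*x*y R (g₁ I) _))) (h (just b ∷ I))) ⟩
      B * (R + q) ^ (size Y ∸ size K)                ∎
      where
      open ≤-Reasoning
      g₁ = g ∘ (just b ∷_)
      x*Ry≡R*x*y : ∀ R x y → x * (R * y) ≡ R * x * y
      x*Ry≡R*x*y = solve-∀
    sumBetween-spread R B (nothing ∷ K) (just c ∷ Y)  p g h = begin
      (sumBetween q K Y g₀ + q * sumBetween q K Y g₁) * (R * R ^ size Y)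
        ≡⟨ lem (sumBetween q K Y g₀) (sumBetween q K Y g₁) q R (R ^ size Y) ⟩
      R * (sumBetween q K Y g₀ * R ^ size Y) + q * (R * sumBetween q K Y g₁ * R ^ size Y)
        ≡⟨ cong (λ t → R * (sumBetween q K Y g₀ * R ^ size Y) + q * (t * R ^ size Y)) (sumBetween-* K Y R g₁) ⟨
      R * (sumBetween q K Y g₀ * R ^ size Y) + q * (sumBetween q K Y (λ I → R * g₁ I) * R ^ size Y)
        ≤⟨ +-mono-≤
             (*-monoʳ-≤ R (sumBetween-spread R B K Y p g₀ (h ∘ (nothing ∷_))))
             (*-monoʳ-≤ q (sumBetween-spread R B K Y p (λ I → R * g₁ I)
               (λ I → ≤-trans (≤-reflexive (lem′ R (g₁ I) _)) (h (just c ∷ I))))) ⟩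
      R * (B * (R + q) ^ d) + q * (B * (R + q) ^ d)
        ≡⟨ lem″ R q B _ ⟩
      B * ((R + q) * (R + q) ^ d)
        ≡⟨ cong (λ d → B * (R + q) ^ d) (+-∸-assoc 1 (⊑⇒size≤ K Y p)) ⟨
      B * (R + q) ^ (suc (size Y) ∸ size K) ∎
      where
      open ≤-Reasoning
      g₀ = g ∘ (nothing ∷_)
      g₁ = g ∘ (just c ∷_)
      d = size Y ∸ size K
      lem : ∀ x y q R z → (x + q * y) * (R * z) ≡ R * (x * z) + q * (R * y * z)
      lem = solve-∀
      lem′ : ∀ R x y → R * x * y ≡ x * (R * y)
      lem′ = solve-∀
      lem″ : ∀ R q B x → R * (B * x) + q * (B * x) ≡ B * ((R + q) * x)
      lem″ = solve-∀

  module _ (u : ℕ) where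

    private q = u + 2

    joint-mass : (K Y Z : Partial n) → T (K ⊑ Y) → T (K ⊑ Z) →
                 sumAbove u Y (λ H → ind (Z ⊑ H)) * q ^ (size Z ∸ size K) ≤
                 mass u Y * sumBetween q K Y (λ I → ind (I ⊑ Z))
    joint-mass [] [] [] p p′ = ≤-refl
    joint-mass (just true ∷ K)  (just true ∷ Y)  (just true ∷ Z)  p p′ = joint-mass K Y Z p p′
    joint-mass (just false ∷ K) (just false ∷ Y) (just false ∷ Z) p p′ = joint-mass K Y Z p p′
    joint-mass (nothing ∷ K) (nothing ∷ Y) (nothing ∷ Z) p p′ = begin
      (u * A + (A + A)) * x               ≡⟨ lem u A x ⟩
      q * (A * x)                         ≤⟨ *-monoʳ-≤ q (joint-mass K Y Z p p′) ⟩
      q * (mass u Y * B)                  ≡⟨ *-assoc q (mass u Y) B ⟨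
      q * mass u Y * B                    ≡⟨ cong (_* B) (mass-nothing u Y) ⟨
      mass u (nothing ∷ Y) * B            ∎
      where
      open ≤-Reasoning
      A = sumAbove u Y (λ H → ind (Z ⊑ H))
      B = sumBetween q K Y (λ I → ind (I ⊑ Z))
      x = q ^ (size Z ∸ size K)
      lem : ∀ u A x → (u * A + (A + A)) * x ≡ (u + 2) * (A * x)
      lem = solve-∀
    joint-mass (nothing ∷ K) (nothing ∷ Y) (just c ∷ Z) p p′ = begin
      S * q ^ (suc (size Z) ∸ size K)     ≡⟨ cong₂ (λ a d → a * q ^ d) (S≡A c) (+-∸-assoc 1 (⊑⇒size≤ K Z p′)) ⟩
      A * (q * x)                         ≡⟨ lem A q x ⟩
      q * (A * x)                         ≤⟨ *-monoʳ-≤ q (joint-mass K Y Z p p′) ⟩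
      q * (mass u Y * B)                  ≡⟨ *-assoc q (mass u Y) B ⟨
      q * mass u Y * B                    ≡⟨ cong (_* B) (mass-nothing u Y) ⟨
      mass u (nothing ∷ Y) * B            ∎
      where
      open ≤-Reasoning
      S = sumAbove u (nothing ∷ Y) (λ H → ind ((just c ∷ Z) ⊑ H))
      A = sumAbove u Y (λ H → ind (Z ⊑ H))
      B = sumBetween q K Y (λ I → ind (I ⊑ Z))
      x = q ^ (size Z ∸ size K)
      S≡A : ∀ c → sumAbove u (nothing ∷ Y) (λ H → ind ((just c ∷ Z) ⊑ H)) ≡ A
      S≡A true  rewrite sumAbove-0 u Y {const 0} (λ _ → refl) | *-zeroʳ u = refl
      S≡A false rewrite sumAbove-0 u Y {const 0} (λ _ → refl) | *-zeroʳ u = +-identityʳ A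
      lem : ∀ A q x → A * (q * x) ≡ q * (A * x)
      lem = solve-∀
    joint-mass (nothing ∷ K) (just b ∷ Y) (nothing ∷ Z) p p′ =
      ≤-trans (joint-mass K Y Z p p′) (*-monoʳ-≤ (mass u Y) (m≤m+n _ _))
    joint-mass (nothing ∷ K) (just b ∷ Y) (just c ∷ Z) p p′
      rewrite +-∸-assoc 1 (⊑⇒size≤ K Z p′) = byBits b c
      where
      open ≤-Reasoning
      A = sumAbove u Y (λ H → ind (Z ⊑ H))
      B = sumBetween q K Y (λ I → ind (I ⊑ Z))
      x = q ^ (size Z ∸ size K)
      agree : A * (q * x) ≤ mass u Y * (B + q * B)
      agree = begin
        A * (q * x)                       ≡⟨ lem A q x ⟩
        q * (A * x)                       ≤⟨ *-monoʳ-≤ q (joint-mass K Y Z p p′) ⟩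
        q * (mass u Y * B)                ≡⟨ lem (mass u Y) q B ⟨
        mass u Y * (q * B)                ≤⟨ *-monoʳ-≤ (mass u Y) (m≤n+m (q * B) B) ⟩
        mass u Y * (B + q * B)            ∎
        where
        lem : ∀ A q x → A * (q * x) ≡ q * (A * x)
        lem = solve-∀
      byBits : ∀ b c → sumAbove u Y (λ H → ind (same c b ∧ (Z ⊑ H))) * (q * x) ≤
                mass u Y * (B + q * sumBetween q K Y (λ I → ind (same b c ∧ (I ⊑ Z))))
      byBits true  true  = agree
      byBits false false = agree
      byBits true  false rewrite sumAbove-0 u Y {const 0} (λ _ → refl) = z≤n
      byBits false true  rewrite sumAbove-0 u Y {const 0} (λ _ → refl) = z≤n

  hit : List (Partial n) → Partial n → Bool
  hit Ys H = any (_⊑ H) Ys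

  miss : List (Partial n) → Partial n → ℕ
  miss Ys H = ind (not (hit Ys H))

  hit-mono : (Ys : List (Partial n)) (H H′ : Partial n) → T (H ⊑ H′) → T (hit Ys H) → T (hit Ys H′)
  hit-mono (Y ∷ Ys) H H′ p q with Y ⊑ H in e | Y ⊑ H′ in e′
  ... | _     | true  = tt
  ... | true  | false = ⊥-elim (subst T e′ (⊑-trans Y H H′ (subst T (sym e) tt) p))
  ... | false | false = hit-mono Ys H H′ p q

  miss-antitone : (Ys : List (Partial n)) → Antitone (miss Ys)
  miss-antitone Ys H H′ p with hit Ys H in e | hit Ys H′ in e′
  ... | _     | true  = z≤n
  ... | false | false = ≤-refl
  ... | true  | false = ⊥-elim (subst T e′ (hit-mono Ys H H′ p (subst T (sym e) tt)))

  hits : List (Partial n) → Partial n → ℕ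
  hits Ys H = ∑ Ys (λ Y → ind (Y ⊑ H))

  hits≡0 : (Ys : List (Partial n)) (H : Partial n) → hit Ys H ≡ false → hits Ys H ≡ 0
  hits≡0 []       H e = refl
  hits≡0 (Y ∷ Ys) H e with Y ⊑ H
  ... | false = hits≡0 Ys H e

  am-gm : ∀ x y → 2 * (x * y) ≤ x * x + y * y
  am-gm x y with ≤-total x y
  ... | inj₁ x≤y = subst (λ y → 2 * (x * y) ≤ x * x + y * y) (m+[n∸m]≡n x≤y) (lem x (y ∸ x))
    where
    lem : ∀ x d → 2 * (x * (x + d)) ≤ x * x + (x + d) * (x + d)
    lem x d = ≤-trans (m≤m+n _ (d * d)) (≤-reflexive (eq x d))
      where
      eq : ∀ x d → 2 * (x * (x + d)) + d * d ≡ x * x + (x + d) * (x + d)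
      eq = solve-∀
  ... | inj₂ y≤x = subst (λ x → 2 * (x * y) ≤ x * x + y * y) (m+[n∸m]≡n y≤x) (lem y (x ∸ y))
    where
    lem : ∀ y d → 2 * ((y + d) * y) ≤ (y + d) * (y + d) + y * y
    lem y d = ≤-trans (m≤m+n _ (d * d)) (≤-reflexive (eq y d))
      where
      eq : ∀ y d → 2 * ((y + d) * y) + d * d ≡ (y + d) * (y + d) + y * y
      eq = solve-∀

  record Spread (R j : ℕ) (K : Partial n) (Ys : List (Partial n)) : Set where
    field
      above  : All (λ Y → T (K ⊑ Y) × size Y ≡ j) Ys
      count  : length Ys * R ^ size K ≡ R ^ j
      degree : ∀ I → ∑ Ys (λ Y → ind (I ⊑ Y)) * R ^ size I ≤ R ^ j

  module _ {R j : ℕ} .{{_ : NonZero R}} {K : Partial n} {Ys : List (Partial n)}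
           (k≤j : size K ≤ j) (spread : Spread R j K Ys) where
    open Spread spread
    private
      d = j ∸ size K
      N = length Ys

    count-∸ : N ≡ R ^ d
    count-∸ = *-cancelʳ-≡ N (R ^ d) (R ^ size K) {{m^n≢0 R (size K)}} (begin
      N * R ^ size K           ≡⟨ count ⟩
      R ^ j                    ≡⟨ cong (R ^_) (m∸n+n≡m k≤j) ⟨
      R ^ (d + size K)         ≡⟨ ^-distribˡ-+-* R d (size K) ⟩
      R ^ d * R ^ size K       ∎)
      where open ≡-Reasoning

    module _ (u : ℕ) where
      private
        q = u + 2
        M = mass u K
        X : Partial n → ℕ
        X H = q ^ d * hits Ys H

      firstMoment : sumAbove u K X ≡ N * M
      firstMoment = begin
        sumAbove u K X                                         ≡⟨ sumAbove-* u K (q ^ d) (hits Ys) ⟩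
        q ^ d * sumAbove u K (hits Ys)                         ≡⟨ cong (q ^ d *_) (sumAbove-∑ u K Ys _) ⟩
        q ^ d * ∑ Ys (λ Y → sumAbove u K (λ H → ind (Y ⊑ H)))  ≡⟨ ∑-*ˡ Ys (q ^ d) _ ⟨
        ∑ Ys (λ Y → q ^ d * sumAbove u K (λ H → ind (Y ⊑ H)))  ≡⟨ go above ⟩
        N * M ∎
        where
        open ≡-Reasoning
        go : ∀ {Zs} → All (λ Y → T (K ⊑ Y) × size Y ≡ j) Zs →
             ∑ Zs (λ Y → q ^ d * sumAbove u K (λ H → ind (Y ⊑ H))) ≡ length Zs * M
        go []                              = refl
        go (_∷_ {x = Y} (p , refl) ps) =
          cong₂ _+_ (trans (cong (q ^ d *_) (sumAbove-ind u K Y p)) (trans (*-comm (q ^ d) _) (mass-⊑ u K Y p))) (go ps)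

      secondMoment : sumAbove u K (λ H → X H * X H) ≤ N * M * (R + q) ^ d
      secondMoment = begin
        sumAbove u K (λ H → X H * X H)
          ≡⟨ sumAbove-cong u K square ⟩
        sumAbove u K (λ H → ∑ Ys λ Y → q ^ d * (ind (Y ⊑ H) * X H))
          ≡⟨ sumAbove-∑ u K Ys _ ⟩
        ∑ Ys (λ Y → sumAbove u K (λ H → q ^ d * (ind (Y ⊑ H) * X H)))
          ≤⟨ ∑-≤-const (All.map (λ { {Y} (p , e) → term Y p e }) above) ⟩
        N * (M * (R + q) ^ d)
          ≡⟨ *-assoc N M _ ⟨
        N * M * (R + q) ^ d ∎
        where
        open ≤-Reasoning
        square : ∀ H → X H * X H ≡ ∑ Ys λ Y → q ^ d * (ind (Y ⊑ H) * X H)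
        square H = sym (trans (∑-*ˡ Ys (q ^ d) _) (trans (cong (q ^ d *_) (∑-*ʳ Ys (X H) _)) (sym (*-assoc (q ^ d) _ (X H)))))
        bound : ∀ Y → T (K ⊑ Y) → size Y ≡ j →
                sumBetween q K Y (λ I → ∑ Ys λ Z → ind (I ⊑ Z)) ≤ (R + q) ^ d
        bound Y p refl = *-cancelʳ-≤ _ _ (R ^ j) {{m^n≢0 R j}}
          (≤-trans (sumBetween-spread q R (R ^ j) K Y p _ degree) (≤-reflexive (*-comm (R ^ j) _)))
        term : ∀ Y → T (K ⊑ Y) → size Y ≡ j →
               sumAbove u K (λ H → q ^ d * (ind (Y ⊑ H) * X H)) ≤ M * (R + q) ^ d
        term Y p e = begin
          sumAbove u K (λ H → q ^ d * (ind (Y ⊑ H) * X H))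
            ≡⟨ sumAbove-* u K (q ^ d) _ ⟩
          q ^ d * sumAbove u K (λ H → ind (Y ⊑ H) * X H)
            ≡⟨ cong (q ^ d *_) (sumAbove-⊑ u K Y p X) ⟩
          q ^ d * sumAbove u Y X
            ≡⟨ cong (q ^ d *_) (trans (sumAbove-* u Y (q ^ d) (hits Ys)) (trans (*-comm (q ^ d) _) (cong (_* q ^ d) (sumAbove-∑ u Y Ys _)))) ⟩
          q ^ d * (∑ Ys (λ Z → sumAbove u Y (λ H → ind (Z ⊑ H))) * q ^ d)
            ≡⟨ cong (q ^ d *_) (∑-*ʳ Ys (q ^ d) _) ⟨
          q ^ d * ∑ Ys (λ Z → sumAbove u Y (λ H → ind (Z ⊑ H)) * q ^ d)
            ≤⟨ *-monoʳ-≤ (q ^ d) (∑-mono-All (All.map (λ { {Z} (p′ , refl) → joint-mass u K Y Z p p′ }) above)) ⟩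
          q ^ d * ∑ Ys (λ Z → mass u Y * sumBetween q K Y (λ I → ind (I ⊑ Z)))
            ≡⟨ cong (q ^ d *_) (∑-*ˡ Ys (mass u Y) _) ⟩
          q ^ d * (mass u Y * ∑ Ys (λ Z → sumBetween q K Y (λ I → ind (I ⊑ Z))))
            ≡⟨ cong (λ t → q ^ d * (mass u Y * t)) (sumBetween-∑ q K Y Ys _) ⟨
          q ^ d * (mass u Y * sumBetween q K Y (λ I → ∑ Ys λ Z → ind (I ⊑ Z)))
            ≤⟨ *-monoʳ-≤ (q ^ d) (*-monoʳ-≤ (mass u Y) (bound Y p e)) ⟩
          q ^ d * (mass u Y * (R + q) ^ d)
            ≡⟨ *-assoc (q ^ d) (mass u Y) _ ⟨
          q ^ d * mass u Y * (R + q) ^ d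
            ≡⟨ cong (_* (R + q) ^ d) (trans (*-comm (q ^ d) _) (cong (λ t → mass u Y * q ^ (t ∸ size K)) (sym e))) ⟩
          mass u Y * q ^ (size Y ∸ size K) * (R + q) ^ d
            ≡⟨ cong (_* (R + q) ^ d) (mass-⊑ u K Y p) ⟩
          M * (R + q) ^ d ∎

      -- Chebyshev's inequality, in the form (X − N)² ≥ N² on the event X = 0.
      miss-rarely : 2 * (R + q) ^ d ≤ 3 * R ^ d → 2 * sumAbove u K (miss Ys) ≤ M
      miss-rarely h = *-cancelˡ-≤ N {{N≢0}} (+-cancelʳ-≤ (2 * (N * M)) _ _ (*-cancelˡ-≤ N {{N≢0}} (begin
        N * (N * (2 * F) + 2 * (N * M))
          ≡⟨ lem₁ N F M ⟩
        2 * (N * N * F + 2 * N * (N * M)) ∸ 2 * (N * N * M)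
          ≤⟨ ∸-monoˡ-≤ (2 * (N * N * M)) (*-monoʳ-≤ 2 chebyshev) ⟩
        2 * (N * M * (R + q) ^ d + N * N * M) ∸ 2 * (N * N * M)
          ≡⟨ lem₂ N M ((R + q) ^ d) ⟩
        N * M * (2 * (R + q) ^ d)
          ≤⟨ *-monoʳ-≤ (N * M) h ⟩
        N * M * (3 * R ^ d)
          ≡⟨ cong (λ t → N * M * (3 * t)) count-∸ ⟨
        N * M * (3 * N)
          ≡⟨ lem₃ N M ⟩
        N * (N * M + 2 * (N * M)) ∎)))
        where
        open ≤-Reasoning
        F = sumAbove u K (miss Ys)
        N≢0 : NonZero N
        N≢0 = subst NonZero (sym count-∸) (m^n≢0 R d)
        pointwise : ∀ H → N * N * miss Ys H + 2 * N * X H ≤ X H * X H + N * N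
        pointwise H with hit Ys H in e
        ... | true  = ≤-trans (≤-reflexive (lem N (X H))) (am-gm (X H) N)
          where
          lem : ∀ N x → N * N * 0 + 2 * N * x ≡ 2 * (x * N)
          lem = solve-∀
        ... | false rewrite hits≡0 Ys H e | *-zeroʳ (q ^ d) = ≤-reflexive (lem N)
          where
          lem : ∀ N → N * N * 1 + 2 * N * 0 ≡ N * N
          lem = solve-∀
        chebyshev : N * N * F + 2 * N * (N * M) ≤ N * M * (R + q) ^ d + N * N * M
        chebyshev = begin
          N * N * F + 2 * N * (N * M)
            ≡⟨ cong₂ _+_ (sumAbove-* u K (N * N) (miss Ys)) (trans (sumAbove-* u K (2 * N) X) (cong (2 * N *_) firstMoment)) ⟨
          sumAbove u K (λ H → N * N * miss Ys H) + sumAbove u K (λ H → 2 * N * X H)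
            ≡⟨ sumAbove-+ u K _ _ ⟨
          sumAbove u K (λ H → N * N * miss Ys H + 2 * N * X H)
            ≤⟨ sumAbove-mono u K pointwise ⟩
          sumAbove u K (λ H → X H * X H + N * N)
            ≡⟨ trans (sumAbove-+ u K _ _) (cong (sumAbove u K (λ H → X H * X H) +_) (sumAbove-const u K (N * N))) ⟩
          sumAbove u K (λ H → X H * X H) + N * N * M
            ≤⟨ +-monoˡ-≤ (N * N * M) secondMoment ⟩
          N * M * (R + q) ^ d + N * N * M ∎
        lem₁ : ∀ N F M → N * (N * (2 * F) + 2 * (N * M)) ≡ 2 * (N * N * F + 2 * N * (N * M)) ∸ 2 * (N * N * M)
        lem₁ N F M = sym (trans (cong (_∸ 2 * (N * N * M)) (eq N F M)) (m+n∸n≡m _ (2 * (N * N * M))))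
          where
          eq : ∀ N F M → 2 * (N * N * F + 2 * N * (N * M)) ≡ N * (N * (2 * F) + 2 * (N * M)) + 2 * (N * N * M)
          eq = solve-∀
        lem₂ : ∀ N M x → 2 * (N * M * x + N * N * M) ∸ 2 * (N * N * M) ≡ N * M * (2 * x)
        lem₂ N M x = trans (cong (_∸ 2 * (N * N * M)) (eq N M x)) (m+n∸n≡m _ (2 * (N * N * M)))
          where
          eq : ∀ N M x → 2 * (N * M * x + N * N * M) ≡ N * M * (2 * x) + 2 * (N * N * M)
          eq = solve-∀
        lem₃ : ∀ N M → N * M * (3 * N) ≡ N * (N * M + 2 * (N * M))
        lem₃ = solve-∀

  binomial-growth : ∀ R q d → 3 * (d * q) ≤ R → 2 * (R + q) ^ d ≤ 3 * R ^ d
  binomial-growth R q zero    h = s≤s (s≤s z≤n)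
  binomial-growth R q (suc d) h = +-cancelʳ-≤ x _ _ (begin
    2 * x + x                          ≡⟨ lem₀ x ⟩
    3 * x                              ≤⟨ *-monoʳ-≤ 3 (bernoulli R q d) ⟩
    3 * (y + suc d * q * z)            ≡⟨ lem y (suc d) q z ⟩
    3 * y + 3 * (suc d * q) * z        ≤⟨ +-monoʳ-≤ (3 * y) (*-monoˡ-≤ z (≤-trans h (m≤m+n R q))) ⟩
    3 * y + x                          ∎)
    where
    open ≤-Reasoning
    x = (R + q) ^ suc d
    y = R ^ suc d
    z = (R + q) ^ d
    lem₀ : ∀ x → 2 * x + x ≡ 3 * x
    lem₀ = solve-∀
    lem : ∀ y s q z → 3 * (y + s * q * z) ≡ 3 * y + 3 * (s * q) * z
    lem = solve-∀

  quasiSunflower : ∀ {R j r} .{{_ : NonZero R}} .{{_ : NonZero r}} {K : Partial n} {Ys : List (Partial n)} →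
                   size K ≤ j → 6 * (r * j) ≤ R → Spread R j K Ys →
                   2 ^ r * sumAbove 0 K (miss Ys) ≤ mass 0 K
  quasiSunflower {R = R} {j} {r@(suc a)} {K = K} {Ys} k≤j 6rj≤R spread =
    *-cancelʳ-≤ _ _ (M ^ r) {{m^n≢0 M r {{>-nonZero (mass>0 (2 * a) K)}}}} (begin
      2 ^ r * sumAbove 0 K (miss Ys) * M ^ r     ≡⟨ *-assoc (2 ^ r) _ _ ⟩
      2 ^ r * (sumAbove 0 K (miss Ys) * M ^ r)   ≤⟨ *-monoʳ-≤ (2 ^ r) (amplify a K (miss Ys) (miss-antitone Ys)) ⟩
      2 ^ r * (mass 0 K * F ^ r)                 ≡⟨ lem (2 ^ r) (mass 0 K) (F ^ r) ⟩
      mass 0 K * (2 ^ r * F ^ r)                 ≡⟨ cong (mass 0 K *_) (^-distribʳ-* 2 F r) ⟨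
      mass 0 K * (2 * F) ^ r                     ≤⟨ *-monoʳ-≤ (mass 0 K) (^-monoˡ-≤ r half) ⟩
      mass 0 K * M ^ r                           ∎)
    where
    open ≤-Reasoning
    M = mass (2 * a) K
    F = sumAbove (2 * a) K (miss Ys)
    lem : ∀ a b c → a * (b * c) ≡ b * (a * c)
    lem = solve-∀
    lem′ : ∀ d a → 3 * (d * (2 * a + 2)) ≡ 6 * ((1 + a) * d)
    lem′ = solve-∀
    half : 2 * F ≤ M
    half = miss-rarely k≤j spread (2 * a) (binomial-growth R (2 * a + 2) (j ∸ size K)
      (≤-trans (≤-reflexive (lem′ (j ∸ size K) a)) (≤-trans (*-monoʳ-≤ 6 (*-monoʳ-≤ r (m∸n≤m j (size K)))) 6rj≤R)))

  allPartials : ∀ n → List (Partial n)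
  allPartials zero    = [] ∷ []
  allPartials (suc n) =
    map (nothing ∷_) (allPartials n) ++
    (map (just false ∷_) (allPartials n) ++ map (just true ∷_) (allPartials n))

  ∈-allPartials : (I : Partial n) → I ∈ allPartials n
  ∈-allPartials []                 = here refl
  ∈-allPartials (nothing ∷ I)      = ∈-++⁺ˡ (∈-map⁺ _ (∈-allPartials I))
  ∈-allPartials {suc n} (just false ∷ I) =
    ∈-++⁺ʳ (map (nothing ∷_) (allPartials n)) (∈-++⁺ˡ (∈-map⁺ _ (∈-allPartials I)))
  ∈-allPartials {suc n} (just true ∷ I)  =
    ∈-++⁺ʳ (map (nothing ∷_) (allPartials n)) (∈-++⁺ʳ (map (just false ∷_) (allPartials n)) (∈-map⁺ _ (∈-allPartials I)))

  maximiser : {P : α → Set} (P? : ∀ x → Dec (P x)) (μ : α → ℕ) (xs : List α) →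
              All (¬_ ∘ P) xs ⊎ (∃[ x ] P x × All (λ y → P y → μ y ≤ μ x) xs)
  maximiser P? μ [] = inj₁ []
  maximiser P? μ (x ∷ xs) with P? x | maximiser P? μ xs
  ... | no ¬p | inj₁ none          = inj₁ (¬p ∷ none)
  ... | no ¬p | inj₂ (y , py , ub) = inj₂ (y , py , ((λ px → ⊥-elim (¬p px)) ∷ ub))
  ... | yes p | inj₁ none          = inj₂ (x , p , ((λ _ → ≤-refl) ∷ All.map (λ ¬q q → ⊥-elim (¬q q)) none))
  ... | yes p | inj₂ (y , py , ub) with ≤-total (μ x) (μ y)
  ...   | inj₁ x≤y = inj₂ (y , py , ((λ _ → x≤y) ∷ ub))
  ...   | inj₂ y≤x = inj₂ (x , p , ((λ _ → ≤-refl) ∷ All.map (λ h q → ≤-trans (h q) y≤x) ub))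

  largest : {P : Partial n → Set} (P? : ∀ I → Dec (P I)) → (∃[ I ] P I) →
            ∃[ K ] P K × (∀ I → P I → size I ≤ size K)
  largest {n} P? (I , pI) with maximiser P? size (allPartials n)
  ... | inj₁ none          = ⊥-elim (All.lookup none (∈-allPartials I) pI)
  ... | inj₂ (K , pK , ub) = K , pK , λ J → All.lookup ub (∈-allPartials J)

  ∑-take : (N : ℕ) (xs : List α) (f : α → ℕ) → ∑ (take N xs) f ≤ ∑ xs f
  ∑-take zero    xs       f = z≤n
  ∑-take (suc N) []       f = z≤n
  ∑-take (suc N) (x ∷ xs) f = +-monoʳ-≤ (f x) (∑-take N xs f)

  ∑-filterᵇ : (p : α → Bool) (xs : List α) (f : α → ℕ) → ∑ (filterᵇ p xs) f ≡ ∑ xs (λ x → ind (p x) * f x)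
  ∑-filterᵇ p []       f = refl
  ∑-filterᵇ p (x ∷ xs) f with p x
  ... | true  = cong₂ _+_ (sym (+-identityʳ (f x))) (∑-filterᵇ p xs f)
  ... | false = ∑-filterᵇ p xs f

  ind-∧ : ∀ a b → ind (a ∧ b) ≡ ind a * ind b
  ind-∧ true  b = sym (+-identityʳ (ind b))
  ind-∧ false b = refl

  ind-mono : ∀ {a b} → (T a → T b) → ind a ≤ ind b
  ind-mono {false}        h = z≤n
  ind-mono {true} {true}  h = ≤-refl
  ind-mono {true} {false} h = ⊥-elim (h tt)

  length-filterᵇ-not : (p : α → Bool) (xs : List α) →
                       length (filterᵇ p xs) + length (filterᵇ (not ∘ p) xs) ≡ length xs
  length-filterᵇ-not p []       = refl
  length-filterᵇ-not p (x ∷ xs) with p x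
  ... | true  = cong suc (length-filterᵇ-not p xs)
  ... | false = trans (+-suc _ _) (cong suc (length-filterᵇ-not p xs))

  ∅ : ∀ n → Partial n
  ∅ n = Vec.replicate n nothing

  size-∅ : ∀ n → size (∅ n) ≡ 0
  size-∅ zero    = refl
  size-∅ (suc n) = size-∅ n

  ∅-⊑ : (Y : Partial n) → T (∅ n ⊑ Y)
  ∅-⊑ []      = tt
  ∅-⊑ (_ ∷ Y) = ∅-⊑ Y

  any-++ : (p : α → Bool) (xs ys : List α) → any p (xs ++ ys) ≡ any p xs ∨ any p ys
  any-++ p []       ys = refl
  any-++ p (x ∷ xs) ys with p x
  ... | true  = refl
  ... | false = any-++ p xs ys

  -- The members are terms of the formula at least one of which is satisfied
  -- almost everywhere on the subcube of the core.
  record Cluster (n : ℕ) : Set where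
    constructor cluster
    field
      core    : Partial n
      members : List (Partial n)

  open Cluster

  cores : List (Cluster n) → List (Partial n)
  cores = map core

  allMembers : List (Cluster n) → List (Partial n)
  allMembers = concatMap members

  miss-allMembers : (cs : List (Cluster n)) (H : Partial n) →
    miss (allMembers cs) H ≤ miss (cores cs) H + ∑ cs (λ c → ind (core c ⊑ H) * miss (members c) H)
  miss-allMembers []       H = ≤-refl
  miss-allMembers (c ∷ cs) H rewrite any-++ (_⊑ H) (members c) (allMembers cs)
    with core c ⊑ H | hit (members c) H | miss-allMembers cs H
  ... | true  | true  | ih = z≤n
  ... | true  | false | ih = ≤-trans (ind≤1 _) (m≤m+n 1 _)
  ... | false | true  | ih = z≤n
  ... | false | false | ih = ih

  module Clustering {n : ℕ} (Good : Partial n → Set) (w r R : ℕ)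
    .{{_ : NonZero r}} (2≤R : 2 ≤ R) (6rw≤R : 6 * (r * w) ≤ R) where

    private instance
      R≢0 : NonZero R
      R≢0 = >-nonZero (≤-trans (s≤s z≤n) 2≤R)

    private
      R^≢0 : ∀ k → NonZero (R ^ k)
      R^≢0 k = m^n≢0 R k

    record Sound (c : Cluster n) : Set where
      field
        narrow : size (core c) ≤ w
        good   : All Good (members c)
        few    : length (members c) * R ^ size (core c) ≤ R ^ w
        close  : 2 ^ r * sumAbove 0 (core c) (miss (members c)) * R ^ size (core c) ≤
                 R ^ w * mass 0 (core c)

    open Sound

    singleton-sound : (S : Partial n) → size S ≤ w → Good S → Sound (cluster S (S ∷ []))
    singleton-sound S S≤w g = record
      { narrow = S≤w
      ; good   = g ∷ []
      ; few    = ≤-trans (≤-reflexive (+-identityʳ _)) (^-monoʳ-≤ R S≤w)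
      ; close  = ≤-trans (≤-reflexive (trans (cong (λ t → 2 ^ r * t * R ^ size S) never)
                                             (cong (_* R ^ size S) (*-zeroʳ (2 ^ r))))) z≤n
      }
      where
      never : sumAbove 0 S (miss (S ∷ [])) ≡ 0
      never = trans (sym (sumAbove-⊑ 0 S S (⊑-refl S) (miss (S ∷ [])))) (sumAbove-0 0 S λ H → disjoint (S ⊑ H))
        where
        disjoint : ∀ b → ind b * ind (not (b ∨ false)) ≡ 0
        disjoint true  = refl
        disjoint false = refl

    module _ {j : ℕ} {K : Partial n} {cs : List (Cluster n)} (j≤w : j ≤ w)
             (spread : Spread R j K (cores cs)) (sound : All Sound cs) where
      open Spread spread
      private k = size K

      above′ : All (λ c → T (K ⊑ core c) × size (core c) ≡ j) cs
      above′ = All.map⁻ above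

      count′ : length cs * R ^ k ≡ R ^ j
      count′ = trans (cong (_* R ^ k) (sym (length-map core cs))) count

      few-allMembers : length (allMembers cs) * R ^ k ≤ R ^ w
      few-allMembers = *-cancelʳ-≤ _ _ (R ^ j) {{R^≢0 j}} (begin
        length (allMembers cs) * R ^ k * R ^ j          ≡⟨ lem (length (allMembers cs)) (R ^ k) (R ^ j) ⟩
        length (allMembers cs) * R ^ j * R ^ k          ≤⟨ *-monoˡ-≤ (R ^ k) (go above′ sound) ⟩
        length cs * R ^ w * R ^ k                       ≡⟨ lem (length cs) (R ^ w) (R ^ k) ⟩
        length cs * R ^ k * R ^ w                       ≡⟨ cong (_* R ^ w) count′ ⟩
        R ^ j * R ^ w                                   ≡⟨ *-comm (R ^ j) _ ⟩
        R ^ w * R ^ j                                   ∎)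
        where
        open ≤-Reasoning
        lem : ∀ a b c → a * b * c ≡ a * c * b
        lem = solve-∀
        go : ∀ {ds} → All (λ c → T (K ⊑ core c) × size (core c) ≡ j) ds → All Sound ds →
             length (allMembers ds) * R ^ j ≤ length ds * R ^ w
        go [] [] = z≤n
        go {d ∷ ds} ((_ , refl) ∷ as) (s ∷ ss) = begin
          length (members d ++ allMembers ds) * R ^ j             ≡⟨ cong (_* R ^ j) (length-++ (members d)) ⟩
          (length (members d) + length (allMembers ds)) * R ^ j   ≡⟨ *-distribʳ-+ (R ^ j) (length (members d)) _ ⟩
          length (members d) * R ^ j + length (allMembers ds) * R ^ j ≤⟨ +-mono-≤ (few s) (go as ss) ⟩
          R ^ w + length ds * R ^ w                               ∎

      close-allMembers : k < j → 2 ^ r * sumAbove 0 K (miss (allMembers cs)) * R ^ k ≤ R ^ w * mass 0 K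
      close-allMembers k<j = *-cancelʳ-≤ _ _ (2 * R ^ j) {{m*n≢0 2 (R ^ j) {{_}} {{R^≢0 j}}}} (begin
        2 ^ r * sumAbove 0 K (miss (allMembers cs)) * R ^ k * (2 * R ^ j)
          ≤⟨ *-monoˡ-≤ (2 * R ^ j) (*-monoˡ-≤ (R ^ k) (*-monoʳ-≤ (2 ^ r) split)) ⟩
        2 ^ r * (A + ∑ cs B) * R ^ k * (2 * R ^ j)
          ≡⟨ lem₁ (2 ^ r) A (∑ cs B) (R ^ k) (R ^ j) ⟩
        2 ^ r * A * (2 * R ^ k * R ^ j) + 2 * (2 ^ r * ∑ cs B * R ^ j) * R ^ k
          ≤⟨ +-mono-≤ (*-mono-≤ (quasiSunflower (<⇒≤ k<j) (≤-trans (*-monoʳ-≤ 6 (*-monoʳ-≤ r j≤w)) 6rw≤R) spread)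
                                (*-monoˡ-≤ (R ^ j) 2R^k≤R^w))
                      (*-monoˡ-≤ (R ^ k) (go above′ sound)) ⟩
        M * (R ^ w * R ^ j) + length cs * (R ^ w * M) * R ^ k
          ≡⟨ lem₂ M (R ^ w) (R ^ j) (length cs) (R ^ k) ⟩
        R ^ w * M * (R ^ j + length cs * R ^ k)
          ≡⟨ cong (λ t → R ^ w * M * (R ^ j + t)) count′ ⟩
        R ^ w * M * (R ^ j + R ^ j)
          ≡⟨ cong (λ t → R ^ w * M * (R ^ j + t)) (+-identityʳ (R ^ j)) ⟨
        R ^ w * M * (2 * R ^ j) ∎)
        where
        open ≤-Reasoning
        M = mass 0 K
        A = sumAbove 0 K (miss (cores cs))
        B : Cluster n → ℕ
        B c = sumAbove 0 K (λ H → ind (core c ⊑ H) * miss (members c) H)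
        split : sumAbove 0 K (miss (allMembers cs)) ≤ A + ∑ cs B
        split = ≤-trans (sumAbove-mono 0 K (miss-allMembers cs))
          (≤-reflexive (trans (sumAbove-+ 0 K _ _) (cong (A +_) (sumAbove-∑ 0 K cs _))))
        2R^k≤R^w : 2 * R ^ k ≤ R ^ w
        2R^k≤R^w = ≤-trans (*-monoˡ-≤ (R ^ k) 2≤R) (^-monoʳ-≤ R (≤-trans k<j j≤w))
        lem₁ : ∀ t a b x y → t * (a + b) * x * (2 * y) ≡ t * a * (2 * x * y) + 2 * (t * b * y) * x
        lem₁ = solve-∀
        lem₂ : ∀ m x y l z → m * (x * y) + l * (x * m) * z ≡ x * m * (y + l * z)
        lem₂ = solve-∀
        lem₃ : ∀ t b c y → 2 * (t * (b + c) * y) ≡ 2 * (t * b * y) + 2 * (t * c * y)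
        lem₃ = solve-∀
        halve : ∀ Y → T (K ⊑ Y) → size Y ≡ j → 2 * mass 0 Y ≤ M
        halve Y p refl = begin
          2 * mass 0 Y                                ≡⟨ *-comm 2 (mass 0 Y) ⟩
          mass 0 Y * 2                                ≤⟨ *-monoʳ-≤ (mass 0 Y) (^-monoʳ-≤ 2 {1} (m<n⇒0<n∸m k<j)) ⟩
          mass 0 Y * 2 ^ (size Y ∸ size K)            ≡⟨ mass-⊑ 0 K Y p ⟩
          M                                           ∎
        go : ∀ {ds} → All (λ c → T (K ⊑ core c) × size (core c) ≡ j) ds → All Sound ds →
             2 * (2 ^ r * ∑ ds B * R ^ j) ≤ length ds * (R ^ w * M)
        go [] [] = ≤-reflexive (cong (λ t → 2 * (t * R ^ j)) (*-zeroʳ (2 ^ r)))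
        go {d ∷ ds} ((p , refl) ∷ as) (s ∷ ss) = begin
          2 * (2 ^ r * (B d + ∑ ds B) * R ^ j)
            ≡⟨ lem₃ (2 ^ r) (B d) (∑ ds B) (R ^ j) ⟩
          2 * (2 ^ r * B d * R ^ j) + 2 * (2 ^ r * ∑ ds B * R ^ j)
            ≡⟨ cong (λ t → 2 * (2 ^ r * t * R ^ j) + 2 * (2 ^ r * ∑ ds B * R ^ j)) (sumAbove-⊑ 0 K (core d) p _) ⟩
          2 * (2 ^ r * sumAbove 0 (core d) (miss (members d)) * R ^ j) + 2 * (2 ^ r * ∑ ds B * R ^ j)
            ≤⟨ +-mono-≤ (*-monoʳ-≤ 2 (close s)) (go as ss) ⟩
          2 * (R ^ w * mass 0 (core d)) + length ds * (R ^ w * M)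
            ≡⟨ cong (_+ length ds * (R ^ w * M)) (lem₄ (R ^ w) (mass 0 (core d))) ⟩
          R ^ w * (2 * mass 0 (core d)) + length ds * (R ^ w * M)
            ≤⟨ +-monoˡ-≤ _ (*-monoʳ-≤ (R ^ w) (halve (core d) p refl)) ⟩
          R ^ w * M + length ds * (R ^ w * M) ∎
          where
          lem₄ : ∀ x m → 2 * (x * m) ≡ x * (2 * m)
          lem₄ = solve-∀

      merge-sound : k < j → Sound (cluster K (allMembers cs))
      merge-sound k<j = record
        { narrow = ≤-trans (<⇒≤ k<j) j≤w
        ; good   = concat⁺ (map⁺ (All.map good sound))
        ; few    = few-allMembers
        ; close  = close-allMembers k<j
        }

    Covers : List (Cluster n) → List (Cluster n) → Set
    Covers cs cs′ = ∀ H → T (hit (cores cs) H) → T (hit (cores cs′) H)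

    hasSize : ℕ → Cluster n → Bool
    hasSize j c = size (core c) ≡ᵇ j

    selected : ℕ → Partial n → Cluster n → Bool
    selected j K c = hasSize j c ∧ (K ⊑ core c)

    covers-replace : (p : Cluster n → Bool) (K : Partial n) → (∀ c → T (p c) → T (K ⊑ core c)) →
                     (Gs : List (Partial n)) (cs : List (Cluster n)) →
                     Covers cs (cluster K Gs ∷ filterᵇ (not ∘ p) cs)
    covers-replace p K p⇒⊑ Gs (c ∷ cs) H h with p c in e | core c ⊑ H in e′
    ... | true  | true  with K ⊑ H in e″
    ...   | true  = tt
    ...   | false = ⊥-elim (subst T e″ (⊑-trans K (core c) H (p⇒⊑ c (subst T (sym e) tt)) (subst T (sym e′) tt)))
    covers-replace p K p⇒⊑ Gs (c ∷ cs) H h | true  | false = covers-replace p K p⇒⊑ Gs cs H h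
    covers-replace p K p⇒⊑ Gs (c ∷ cs) H h | false | true  rewrite e′ with K ⊑ H
    ... | true  = tt
    ... | false = tt
    covers-replace p K p⇒⊑ Gs (c ∷ cs) H h | false | false rewrite e′ = covers-replace p K p⇒⊑ Gs cs H h

    module _ (cs : List (Cluster n)) (sound : All Sound cs) (j : ℕ) (j≤w : j ≤ w) where

      private
        chosen : Partial n → List (Cluster n)
        chosen K = filterᵇ (selected j K) cs

        chosen-selected : ∀ K → All (λ c → T (K ⊑ core c) × size (core c) ≡ j) (chosen K)
        chosen-selected K = All.map (λ {c} h → proj₂ (T-∧⁻ {hasSize j c} h) , ≡ᵇ⇒≡ _ _ (proj₁ (T-∧⁻ {hasSize j c} h)))
                                    (all-filter (λ c → T? (selected j K c)) cs)

        Heavy : Partial n → Set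
        Heavy K = R ^ j < length (chosen K) * R ^ size K

        replace : ∀ K (c : Cluster n) → core c ≡ K → Sound c → 1 < length (chosen K) →
                  ∃[ cs′ ] length cs′ < length cs × All Sound cs′ × Covers cs cs′
        replace K (cluster .K Gs) refl s 1<l = cluster K Gs ∷ rest ,
          subst (suc (length rest) <_) (length-filterᵇ-not (selected j K) cs) (+-monoˡ-< (length rest) 1<l) ,
          s ∷ filter⁺ (λ c → T? (not (selected j K c))) sound ,
          covers-replace (selected j K) K (λ c h → proj₂ (T-∧⁻ {hasSize j c} h)) Gs cs
          where rest = filterᵇ (not ∘ selected j K) cs

      module Compress (K : Partial n) (heavy : Heavy K) (maximal : ∀ I → Heavy I → size I ≤ size K) where
        private
          k = size K

          nonempty : 0 < length (chosen K)
          nonempty = positive heavy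
            where
            positive : ∀ {a b c} → a < b * c → 0 < b
            positive {b = suc _} _ = s≤s z≤n

          member : ∃[ c ] T (K ⊑ core c) × size (core c) ≡ j × Sound c
          member = first (chosen-selected K) (filter⁺ (λ c → T? (selected j K c)) sound) nonempty
            where
            first : ∀ {es} → All (λ c → T (K ⊑ core c) × size (core c) ≡ j) es → All Sound es → 0 < length es →
                    ∃[ c ] T (K ⊑ core c) × size (core c) ≡ j × Sound c
            first ((p , e) ∷ _) (s ∷ _) _ = _ , p , e , s

          k≤j : k ≤ j
          k≤j with c , p , e , _ ← member = subst (k ≤_) e (⊑⇒size≤ K (core c) p)

          N : ℕ
          N = R ^ (j ∸ k)

          N*R^k : N * R ^ k ≡ R ^ j
          N*R^k = trans (sym (^-distribˡ-+-* R (j ∸ k) k)) (cong (R ^_) (m∸n+n≡m k≤j))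

          N<chosen : N < length (chosen K)
          N<chosen = *-cancelʳ-< (R ^ k) _ _ (subst (_< length (chosen K) * R ^ k) (sym N*R^k) heavy)

          ds : List (Cluster n)
          ds = take N (chosen K)

          length-ds : length ds ≡ N
          length-ds = trans (length-take N (chosen K)) (m≤n⇒m⊓n≡m (<⇒≤ N<chosen))

          above-ds : All (λ c → T (K ⊑ core c) × size (core c) ≡ j) ds
          above-ds = take⁺ N (chosen-selected K)

          sound-ds : All Sound ds
          sound-ds = take⁺ N (filter⁺ (λ c → T? (selected j K c)) sound)

          1<chosen : 1 < length (chosen K)
          1<chosen = ≤-<-trans (>-nonZero⁻¹ N {{R^≢0 (j ∸ k)}}) N<chosen

          degree≤chosen : ∀ I → ∑ (cores ds) (λ Y → ind (I ⊑ Y)) ≤ length (chosen I)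
          degree≤chosen I = begin
            ∑ (cores ds) (λ Y → ind (I ⊑ Y))                      ≡⟨ ∑-map core ds _ ⟩
            ∑ ds (λ c → ind (I ⊑ core c))                         ≤⟨ ∑-take N (chosen K) _ ⟩
            ∑ (chosen K) (λ c → ind (I ⊑ core c))                 ≡⟨ ∑-filterᵇ (selected j K) cs _ ⟩
            ∑ cs (λ c → ind (selected j K c) * ind (I ⊑ core c))  ≤⟨ ∑-mono cs pointwise ⟩
            ∑ cs (λ c → ind (selected j I c))                     ≡⟨ length-filterᵇ (selected j I) cs ⟨
            length (chosen I)                                     ∎
            where
            open ≤-Reasoning
            pointwise : ∀ c → ind (selected j K c) * ind (I ⊑ core c) ≤ ind (selected j I c)
            pointwise c = ≤-trans (≤-reflexive (sym (ind-∧ (selected j K c) _)))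
              (ind-mono λ h → let (h₁ , h₂) = T-∧⁻ {selected j K c} h in T-∧⁺ (proj₁ (T-∧⁻ {hasSize j c} h₁)) h₂)

          degree : ∀ I → ∑ (cores ds) (λ Y → ind (I ⊑ Y)) * R ^ size I ≤ R ^ j
          degree I with size I ≤? k
          ... | yes i≤k = ≤-trans (*-mono-≤ (≤-trans (∑-≤-const (All.universal (λ Y → ind≤1 (I ⊑ Y)) (cores ds)))
                                                     (≤-reflexive (trans (*-identityʳ _) (trans (length-map core ds) length-ds))))
                                            (^-monoʳ-≤ R i≤k))
                                  (≤-reflexive N*R^k)
          ... | no i≰k  = ≤-trans (*-monoˡ-≤ (R ^ size I) (degree≤chosen I)) (≮⇒≥ λ h → i≰k (maximal I h))

          spread-ds : Spread R j K (cores ds)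
          spread-ds = record
            { above  = map⁺ above-ds
            ; count  = trans (cong (_* R ^ k) (trans (length-map core ds) length-ds)) N*R^k
            ; degree = degree
            }

        compressed : ∃[ cs′ ] length cs′ < length cs × All Sound cs′ × Covers cs cs′
        compressed with k <? j
        ... | yes k<j = replace K (cluster K (allMembers ds)) refl (merge-sound j≤w spread-ds sound-ds k<j) 1<chosen
        ... | no k≮j with c , p , e , s ← member =
          replace K c (sym (⊑∧size≥⇒≡ K (core c) p (≤-trans (≤-reflexive e) (≮⇒≥ k≮j)))) s 1<chosen

      compress : R ^ j < ∑ cs (ind ∘ hasSize j) →
                 ∃[ cs′ ] length cs′ < length cs × All Sound cs′ × Covers cs cs′
      compress big with largest (λ I → R ^ j <? length (chosen I) * R ^ size I) (∅ n , start)
        where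
        start : Heavy (∅ n)
        start rewrite size-∅ n | *-identityʳ (length (chosen (∅ n))) | length-filterᵇ (selected j (∅ n)) cs =
          subst (R ^ j <_) (∑-cong cs λ c → sym (ind-∧-T (hasSize j c) (∅-⊑ (core c)))) big
          where
          ind-∧-T : ∀ a {b} → T b → ind (a ∧ b) ≡ ind a
          ind-∧-T true  {true} _ = refl
          ind-∧-T false {true} _ = refl
      ... | K , heavy , maximal = Compress.compressed K heavy maximal

    Sparse : List (Cluster n) → Set
    Sparse cs = ∀ j → j ≤ w → ∑ cs (ind ∘ hasSize j) ≤ R ^ j

    cluster-sparsely : ∀ fuel cs → length cs ≤ fuel → All Sound cs →
                       ∃[ cs′ ] All Sound cs′ × Covers cs cs′ × Sparse cs′
    cluster-sparsely fuel cs l sound with anyUpTo? (λ j → R ^ j <? ∑ cs (ind ∘ hasSize j)) (suc w)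
    ... | no ¬big = cs , sound , (λ H h → h) , λ j j≤w → ≮⇒≥ λ h → ¬big (j , s≤s j≤w , h)
    cluster-sparsely fuel cs l sound | yes (j , s≤s j≤w , big) with compress cs sound j j≤w big
    cluster-sparsely zero cs l sound | yes _ | _ , l′ , _ = ⊥-elim (n≮0 (≤-trans l′ l))
    cluster-sparsely (suc fuel) cs l sound | yes _ | cs′ , l′ , sound′ , cov
      with cluster-sparsely fuel cs′ (s≤s⁻¹ (≤-trans l′ l)) sound′
    ... | cs″ , sound″ , cov′ , sparse = cs″ , sound″ , (λ H h → cov′ H (cov H h)) , sparse

    ∑-sparse : (cs : List (Cluster n)) → Sparse cs → (g : Cluster n → ℕ) (B : ℕ) →
               All (λ c → size (core c) ≤ w × g c * R ^ size (core c) ≤ B) cs →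
               ∑ cs g ≤ suc w * B
    ∑-sparse cs sparse g B hyps = ≤-trans (∑-mono-All (All.map below hyps)) (upTo (suc w) ≤-refl)
      where
      open ≤-Reasoning
      ind-T : ∀ {b} → T b → ind b ≡ 1
      ind-T {true} _ = refl
      below : ∀ {c} → size (core c) ≤ w × g c * R ^ size (core c) ≤ B → g c ≤ ind (size (core c) <ᵇ suc w) * g c
      below {c} (h , _) rewrite ind-T (<⇒<ᵇ (s≤s h)) = ≤-reflexive (sym (+-identityʳ (g c)))
      layer : ∀ j → j ≤ w → ∑ cs (λ c → ind (hasSize j c) * g c) ≤ B
      layer j j≤w = *-cancelʳ-≤ _ _ (R ^ j) {{R^≢0 j}} (begin
        ∑ cs (λ c → ind (hasSize j c) * g c) * R ^ j   ≡⟨ ∑-*ʳ cs (R ^ j) _ ⟨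
        ∑ cs (λ c → ind (hasSize j c) * g c * R ^ j)   ≤⟨ ∑-mono-All (All.map pointwise hyps) ⟩
        ∑ cs (λ c → ind (hasSize j c) * B)             ≡⟨ ∑-*ʳ cs B _ ⟩
        ∑ cs (ind ∘ hasSize j) * B                     ≤⟨ *-monoˡ-≤ B (sparse j j≤w) ⟩
        R ^ j * B                                      ≡⟨ *-comm (R ^ j) B ⟩
        B * R ^ j                                      ∎)
        where
        pointwise : ∀ {c} → size (core c) ≤ w × g c * R ^ size (core c) ≤ B →
                    ind (hasSize j c) * g c * R ^ j ≤ ind (hasSize j c) * B
        pointwise {c} (_ , h) with hasSize j c in e
        ... | false = z≤n
        ... | true with refl ← ≡ᵇ⇒≡ (size (core c)) j (subst T (sym e) tt) =
          ≤-trans (≤-reflexive (cong (_* R ^ j) (+-identityʳ (g c)))) (≤-trans h (≤-reflexive (sym (+-identityʳ B))))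
      step : ∀ s v → ind (s <ᵇ suc v) ≤ ind (s <ᵇ v) + ind (s ≡ᵇ v)
      step zero    zero    = ≤-refl
      step zero    (suc v) = ≤-refl
      step (suc s) zero    = z≤n
      step (suc s) (suc v) = step s v
      upTo : ∀ v → v ≤ suc w → ∑ cs (λ c → ind (size (core c) <ᵇ v) * g c) ≤ v * B
      upTo zero    _ = ≤-reflexive (trans (∑-const cs 0) (*-zeroʳ (length cs)))
      upTo (suc v) h = begin
        ∑ cs (λ c → ind (size (core c) <ᵇ suc v) * g c)
          ≤⟨ ∑-mono cs (λ c → ≤-trans (*-monoˡ-≤ (g c) (step (size (core c)) v)) (≤-reflexive (*-distribʳ-+ (g c) (ind (size (core c) <ᵇ v)) (ind (hasSize v c))))) ⟩
        ∑ cs (λ c → ind (size (core c) <ᵇ v) * g c + ind (hasSize v c) * g c)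
          ≡⟨ ∑-+ cs _ _ ⟩
        ∑ cs (λ c → ind (size (core c) <ᵇ v) * g c) + ∑ cs (λ c → ind (hasSize v c) * g c)
          ≤⟨ +-mono-≤ (upTo v (<⇒≤ h)) (layer v (s≤s⁻¹ h)) ⟩
        v * B + B
          ≡⟨ +-comm (v * B) B ⟩
        B + v * B ∎

  T-hit : {P H : Partial n} {Ps : List (Partial n)} → P ∈ Ps → T (P ⊑ H) → T (hit Ps H)
  T-hit {H = H} {Ps = Q ∷ Ps} (here refl) h with Q ⊑ H
  ... | true = tt
  T-hit {H = H} {Ps = Q ∷ Ps} (there i)   h with Q ⊑ H
  ... | true  = tt
  ... | false = T-hit i h

  hit-All : {Q : Partial n → Set} {H : Partial n} {Ps : List (Partial n)} → All Q Ps → T (hit Ps H) →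
            ∃[ P ] Q P × T (P ⊑ H)
  hit-All {H = H} {Ps = P ∷ Ps} (q ∷ qs) h with P ⊑ H in e
  ... | true  = P , q , subst T (sym e) tt
  ... | false = hit-All qs h

  record Sandwich (w r R : ℕ) (F : List (Partial n)) : Set where
    field
      Fℓ Fᵤ    : List (Partial n)
      narrowℓ  : All (λ P → size P ≤ w) Fℓ
      narrowᵤ  : All (λ P → size P ≤ w) Fᵤ
      lengthℓ  : length Fℓ ≤ suc w * R ^ w
      lengthᵤ  : length Fᵤ ≤ suc w * R ^ w
      lower    : ∀ H → T (hit Fℓ H) → T (hit F H)
      upper    : ∀ H → T (hit F H) → T (hit Fᵤ H)
      gap      : 2 ^ r * sumAbove 0 (∅ n) (λ H → ind (hit Fᵤ H ∧ not (hit Fℓ H))) ≤ suc w * (R ^ w * mass 0 (∅ n))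

  mass-antitone : (Y : Partial n) → mass 0 Y ≤ mass 0 (∅ n)
  mass-antitone {n} Y = ≤-trans (m≤m*n (mass 0 Y) (2 ^ (size Y ∸ size (∅ n))) {{m^n≢0 2 (size Y ∸ size (∅ n))}})
                            (≤-reflexive (mass-⊑ 0 (∅ n) Y (∅-⊑ Y)))

  length-concatMap : (g : α → List β) (xs : List α) → length (concatMap g xs) ≡ ∑ xs (length ∘ g)
  length-concatMap g []       = refl
  length-concatMap g (x ∷ xs) = trans (length-++ (g x)) (cong (length (g x) +_) (length-concatMap g xs))

  module _ {n : ℕ} (w r R : ℕ) .{{_ : NonZero r}} (2≤R : 2 ≤ R) (6rw≤R : 6 * (r * w) ≤ R)
           (F : List (Partial n)) (narrow : All (λ P → size P ≤ w) F) where

    open Clustering (λ P → size P ≤ w × P ∈ F) w r R 2≤R 6rw≤R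
    open Cluster

    private
      single : Partial n → Cluster n
      single S = cluster S (S ∷ [])

      single-sound : All Sound (map single F)
      single-sound = map⁺ (All.tabulate λ {S} S∈F →
        singleton-sound S (All.lookup narrow S∈F) (All.lookup narrow S∈F , S∈F))

      cores-single : ∀ G → cores (map single G) ≡ G
      cores-single []      = refl
      cores-single (S ∷ G) = cong (S ∷_) (cores-single G)

      module _ (cs : List (Cluster n)) (sound : All Sound cs) (sparse : Sparse cs) where

        gap-pointwise : ∀ H → ind (hit (cores cs) H ∧ not (hit (allMembers cs) H)) ≤
                        ∑ cs (λ c → ind (core c ⊑ H) * miss (members c) H)
        gap-pointwise H with hit (cores cs) H | miss-allMembers cs H
        ... | false | _ = z≤n
        ... | true  | h = h

        gap-small : 2 ^ r * sumAbove 0 (∅ n) (λ H → ind (hit (cores cs) H ∧ not (hit (allMembers cs) H))) ≤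
                    suc w * (R ^ w * mass 0 (∅ n))
        gap-small = begin
          2 ^ r * sumAbove 0 (∅ n) (λ H → ind (hit (cores cs) H ∧ not (hit (allMembers cs) H)))
            ≤⟨ *-monoʳ-≤ (2 ^ r) (sumAbove-mono 0 (∅ n) gap-pointwise) ⟩
          2 ^ r * sumAbove 0 (∅ n) (λ H → ∑ cs (λ c → ind (core c ⊑ H) * miss (members c) H))
            ≡⟨ cong (2 ^ r *_) (sumAbove-∑ 0 (∅ n) cs _) ⟩
          2 ^ r * ∑ cs (λ c → sumAbove 0 (∅ n) (λ H → ind (core c ⊑ H) * miss (members c) H))
            ≡⟨ cong (2 ^ r *_) (∑-cong cs λ c → sumAbove-⊑ 0 (∅ n) (core c) (∅-⊑ (core c)) _) ⟩
          2 ^ r * ∑ cs (λ c → sumAbove 0 (core c) (miss (members c)))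
            ≡⟨ ∑-*ˡ cs (2 ^ r) _ ⟨
          ∑ cs (λ c → 2 ^ r * sumAbove 0 (core c) (miss (members c)))
            ≤⟨ ∑-sparse cs sparse _ _ (All.map (λ {c} s → Sound.narrow s ,
                 ≤-trans (Sound.close s) (*-monoʳ-≤ (R ^ w) (mass-antitone (core c)))) sound) ⟩
          suc w * (R ^ w * mass 0 (∅ n)) ∎
          where open ≤-Reasoning

        good-members : All (λ P → size P ≤ w × P ∈ F) (allMembers cs)
        good-members = concat⁺ (map⁺ (All.map Sound.good sound))

    sandwich : Sandwich w r R F
    sandwich with cs , sound , covers , sparse ← cluster-sparsely _ (map single F) ≤-refl single-sound = record
      { Fℓ      = allMembers cs
      ; Fᵤ      = cores cs
      ; narrowℓ = All.map proj₁ (good-members cs sound sparse)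
      ; narrowᵤ = map⁺ (All.map Sound.narrow sound)
      ; lengthℓ = ≤-trans (≤-reflexive (length-concatMap members cs))
                          (∑-sparse cs sparse (length ∘ members) (R ^ w) (All.map (λ s → Sound.narrow s , Sound.few s) sound))
      ; lengthᵤ = ≤-trans (≤-reflexive (trans (length-map core cs) (trans (sym (*-identityʳ _)) (sym (∑-const cs 1)))))
                          (∑-sparse cs sparse (const 1) (R ^ w) (All.map (λ s → Sound.narrow s ,
                            ≤-trans (≤-reflexive (+-identityʳ _)) (^-monoʳ-≤ R {{R≢0}} (Sound.narrow s))) sound))
      ; lower   = λ H h → let (P , (_ , P∈F) , P⊑H) = hit-All (good-members cs sound sparse) h in T-hit P∈F P⊑H
      ; upper   = λ H h → covers H (subst (λ Ps → T (hit Ps H)) (sym (cores-single F)) h)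
      ; gap     = gap-small cs sound sparse
      }
      where
      R≢0 : NonZero R
      R≢0 = >-nonZero (≤-trans (s≤s z≤n) 2≤R)

  holds : (α → Bool) → Maybe α → Bool
  holds p (just x) = p x
  holds p nothing  = false

  complete : Vec Bool n → Partial n
  complete = Vec.map just

  insert : Fin n → Bool → Partial n → Maybe (Partial n)
  insert zero    b (nothing ∷ P) = just (just b ∷ P)
  insert zero    b (just c ∷ P)  = if same b c then just (just c ∷ P) else nothing
  insert (suc i) b (x ∷ P)       = Maybe.map (x ∷_) (insert i b P)

  insert-⊑ : (i : Fin n) (b : Bool) (P : Partial n) (z : Vec Bool n) →
             holds (_⊑ complete z) (insert i b P) ≡ same b (lookup z i) ∧ (P ⊑ complete z)
  insert-⊑ zero    b     (nothing ∷ P)    (c ∷ z)     = refl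
  insert-⊑ zero    true  (just true ∷ P)  (true ∷ z)  = refl
  insert-⊑ zero    true  (just true ∷ P)  (false ∷ z) = refl
  insert-⊑ zero    true  (just false ∷ P) (true ∷ z)  = refl
  insert-⊑ zero    true  (just false ∷ P) (false ∷ z) = refl
  insert-⊑ zero    false (just true ∷ P)  (true ∷ z)  = refl
  insert-⊑ zero    false (just true ∷ P)  (false ∷ z) = refl
  insert-⊑ zero    false (just false ∷ P) (true ∷ z)  = refl
  insert-⊑ zero    false (just false ∷ P) (false ∷ z) = refl
  insert-⊑ (suc i) b     (nothing ∷ P)    (c ∷ z)     with insert i b P | insert-⊑ i b P z
  ... | just _  | ih = ih
  ... | nothing | ih = ih
  insert-⊑ (suc i) b     (just d ∷ P)     (c ∷ z)     with insert i b P | insert-⊑ i b P z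
  ... | nothing | ih with same d c
  ...   | true  = ih
  ...   | false = sym (∧-zeroʳ _)
  insert-⊑ (suc i) b     (just d ∷ P)     (c ∷ z)     | just Q | ih with same d c
  ...   | true  = ih
  ...   | false = sym (∧-zeroʳ _)

  insert-size : (i : Fin n) (b : Bool) (P : Partial n) {Q : Partial n} → insert i b P ≡ just Q → size Q ≤ suc (size P)
  insert-size zero    b (nothing ∷ P) refl = ≤-refl
  insert-size zero    b (just c ∷ P)  e with same b c
  insert-size zero    b (just c ∷ P)  refl | true = n≤1+n _
  insert-size (suc i) b (nothing ∷ P) e with insert i b P in e′
  insert-size (suc i) b (nothing ∷ P) refl | just Q = insert-size i b P e′
  insert-size (suc i) b (just c ∷ P)  e with insert i b P in e′
  insert-size (suc i) b (just c ∷ P)  refl | just Q = s≤s (insert-size i b P e′)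

  insertLiteral : Literal (Fin n) → Partial n → Maybe (Partial n)
  insertLiteral (pos i) = insert i true
  insertLiteral (neg i) = insert i false

  toPartial : Term (Fin n) → Maybe (Partial n)
  toPartial []      = just (∅ _)
  toPartial (l ∷ t) = toPartial t Maybe.>>= insertLiteral l

  ∅-⊑≡true : (z : Vec Bool n) → (∅ _ ⊑ complete z) ≡ true
  ∅-⊑≡true []      = refl
  ∅-⊑≡true (b ∷ z) = ∅-⊑≡true z

  toPartial-⊑ : (t : Term (Fin n)) (z : Vec Bool n) →
                holds (_⊑ complete z) (toPartial t) ≡ evalTerm (lookup z) t
  toPartial-⊑ []      z = ∅-⊑≡true z
  toPartial-⊑ (l ∷ t) z with toPartial t | toPartial-⊑ t z
  toPartial-⊑ (pos i ∷ t) z | just P  | ih = trans (insert-⊑ i true P z) (cong (lookup z i ∧_) ih)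
  toPartial-⊑ (neg i ∷ t) z | just P  | ih = trans (insert-⊑ i false P z) (cong (not (lookup z i) ∧_) ih)
  toPartial-⊑ (l ∷ t) z     | nothing | ih = trans (sym (∧-zeroʳ (evalLiteral (lookup z) l))) (cong (evalLiteral (lookup z) l ∧_) ih)

  toPartial-size : (t : Term (Fin n)) {P : Partial n} → toPartial t ≡ just P → size P ≤ length t
  toPartial-size {n} [] refl = ≤-reflexive (size-∅ n)
  toPartial-size (l ∷ t) e with toPartial t in e′
  toPartial-size (pos i ∷ t) e | just P = ≤-trans (insert-size i true P e) (s≤s (toPartial-size t e′))
  toPartial-size (neg i ∷ t) e | just P = ≤-trans (insert-size i false P e) (s≤s (toPartial-size t e′))

  hit-mapMaybe : (g : α → Maybe (Partial n)) (ev : α → Bool) (H : Partial n) →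
                 (∀ t → holds (_⊑ H) (g t) ≡ ev t) →
                 (ts : List α) → hit (mapMaybe g ts) H ≡ any ev ts
  hit-mapMaybe g ev H h []       = refl
  hit-mapMaybe g ev H h (t ∷ ts) with g t | h t
  ... | just P  | e = cong₂ _∨_ e (hit-mapMaybe g ev H h ts)
  ... | nothing | e rewrite sym e = hit-mapMaybe g ev H h ts

  toPartials : DNF (Fin n) → List (Partial n)
  toPartials = mapMaybe toPartial

  hit-toPartials : (f : DNF (Fin n)) (z : Vec Bool n) → hit (toPartials f) (complete z) ≡ ⟦ f ⟧ z
  hit-toPartials f z = hit-mapMaybe toPartial _ (complete z) (λ t → toPartial-⊑ t z) f

  toPartials-size : {w : ℕ} (f : DNF (Fin n)) → HasWidth w f → All (λ P → size P ≤ w) (toPartials f)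
  toPartials-size []      []       = []
  toPartials-size (t ∷ f) (h ∷ hs) with toPartial t in e
  ... | just P  = ≤-trans (toPartial-size t e) h ∷ toPartials-size f hs
  ... | nothing = toPartials-size f hs

  ∑-points : (L : Subset n) (g : Partial n → ℕ) →
             ∑ (points (∁ L)) (λ x → ∑ (points L) (λ y → g (complete (merge x y)))) ≡ sumAbove 0 (∅ n) g
  ∑-points []            g = trans (+-identityʳ _) (+-identityʳ _)
  ∑-points {suc n} (inside ∷ L)  g = begin
    ∑ (map skip (points (∁ L))) (λ x → ∑ (map (false ∷_) (points L) ++ map (true ∷_) (points L)) (λ y → g (complete (merge x y))))
      ≡⟨ ∑-map skip (points (∁ L)) _ ⟩
    ∑ (points (∁ L)) (λ x → ∑ (map (false ∷_) (points L) ++ map (true ∷_) (points L)) (λ y → g (complete (merge (skip x) y))))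
      ≡⟨ ∑-cong (points (∁ L)) (λ x → trans (∑-++ (map (false ∷_) (points L)) _ _)
           (cong₂ _+_ (∑-map (false ∷_) (points L) _) (∑-map (true ∷_) (points L) _))) ⟩
    ∑ (points (∁ L)) (λ x → ∑ (points L) (λ y → g (just false ∷ complete (merge x y))) +
                             ∑ (points L) (λ y → g (just true ∷ complete (merge x y))))
      ≡⟨ ∑-+ (points (∁ L)) _ _ ⟩
    _ ≡⟨ cong₂ _+_ (∑-points L (g ∘ (just false ∷_))) (∑-points L (g ∘ (just true ∷_))) ⟩
    sumAbove 0 (∅ (suc n)) g ∎
    where open ≡-Reasoning
  ∑-points {suc n} (outside ∷ L) g = begin
    ∑ (map (false ∷_) (points (∁ L)) ++ map (true ∷_) (points (∁ L))) (λ x → ∑ (map skip (points L)) (λ y → g (complete (merge x y))))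
      ≡⟨ trans (∑-++ (map (false ∷_) (points (∁ L))) _ _)
           (cong₂ _+_ (∑-map (false ∷_) (points (∁ L)) _) (∑-map (true ∷_) (points (∁ L)) _)) ⟩
    _ ≡⟨ cong₂ _+_ (∑-cong (points (∁ L)) λ x → ∑-map skip (points L) _) (∑-cong (points (∁ L)) λ x → ∑-map skip (points L) _) ⟩
    _ ≡⟨ cong₂ _+_ (∑-points L (g ∘ (just false ∷_))) (∑-points L (g ∘ (just true ∷_))) ⟩
    sumAbove 0 (∅ (suc n)) g ∎
    where open ≡-Reasoning

  points-nonempty : (L : Subset n) → 0 < length (points L)
  points-nonempty []            = s≤s z≤n
  points-nonempty (inside ∷ L)  = ≤-trans (points-nonempty L)
    (≤-trans (≤-reflexive (sym (length-map _ (points L)))) (≤-trans (m≤m+n _ _) (≤-reflexive (sym (length-++ (map (false ∷_) (points L)))))))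
  points-nonempty (outside ∷ L) = ≤-trans (points-nonempty L) (≤-reflexive (sym (length-map _ (points L))))

  length-points : (L : Subset n) → length (points (∁ L)) * length (points L) ≡ mass 0 (∅ n)
  length-points {n} L = begin
    length (points (∁ L)) * length (points L)              ≡⟨ ∑-const (points (∁ L)) _ ⟨
    ∑ (points (∁ L)) (λ x → length (points L))             ≡⟨ ∑-cong (points (∁ L)) (λ x → trans (sym (*-identityʳ _)) (sym (∑-const (points L) 1))) ⟩
    ∑ (points (∁ L)) (λ x → ∑ (points L) (const 1))        ≡⟨ ∑-points L (const 1) ⟩
    mass 0 (∅ n)                                               ∎
    where open ≡-Reasoning

  markov : (L : Subset n) (E : Partial n → Bool) (m : ℕ) →
           2 ^ m * (2 ^ m * sumAbove 0 (∅ n) (ind ∘ E)) ≤ mass 0 (∅ n) →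
           2 ^ m * ∑ (points (∁ L)) (λ x → ind (length (points L) <ᵇ 2 ^ m * ∑ (points L) (λ y → ind (E (complete (merge x y)))))) ≤
           length (points (∁ L))
  markov {n} L E m h = *-cancelʳ-≤ _ _ l {{>-nonZero (points-nonempty L)}} (begin
    2 ^ m * ∑ (points (∁ L)) (λ x → ind (l <ᵇ 2 ^ m * err x)) * l
      ≡⟨ *-assoc (2 ^ m) _ l ⟩
    2 ^ m * (∑ (points (∁ L)) (λ x → ind (l <ᵇ 2 ^ m * err x)) * l)
      ≡⟨ cong (2 ^ m *_) (∑-*ʳ (points (∁ L)) l _) ⟨
    2 ^ m * ∑ (points (∁ L)) (λ x → ind (l <ᵇ 2 ^ m * err x) * l)
      ≤⟨ *-monoʳ-≤ (2 ^ m) (∑-mono (points (∁ L)) pointwise) ⟩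
    2 ^ m * ∑ (points (∁ L)) (λ x → 2 ^ m * err x)
      ≡⟨ cong (2 ^ m *_) (∑-*ˡ (points (∁ L)) (2 ^ m) err) ⟩
    2 ^ m * (2 ^ m * ∑ (points (∁ L)) err)
      ≡⟨ cong (λ t → 2 ^ m * (2 ^ m * t)) (∑-points L (ind ∘ E)) ⟩
    2 ^ m * (2 ^ m * sumAbove 0 (∅ n) (ind ∘ E))
      ≤⟨ h ⟩
    mass 0 (∅ n)
      ≡⟨ length-points L ⟨
    length (points (∁ L)) * l ∎)
    where
    open ≤-Reasoning
    l = length (points L)
    err : Cube (∁ L) → ℕ
    err x = ∑ (points L) (λ y → ind (E (complete (merge x y))))
    pointwise : ∀ x → ind (l <ᵇ 2 ^ m * err x) * l ≤ 2 ^ m * err x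
    pointwise x with l <ᵇ 2 ^ m * err x in e
    ... | false = z≤n
    ... | true  = ≤-trans (≤-reflexive (+-identityʳ l)) (<⇒≤ (<ᵇ⇒< l _ (subst T (sym e) tt)))

  liveSize : Subset n → Partial n → ℕ
  liveSize []            []            = 0
  liveSize (_ ∷ L)       (nothing ∷ P) = liveSize L P
  liveSize (inside ∷ L)  (just _ ∷ P)  = suc (liveSize L P)
  liveSize (outside ∷ L) (just _ ∷ P)  = liveSize L P

  literal : {V : Set} → Bool → V → Literal V
  literal true  = pos
  literal false = neg

  shift : {L : Subset n} {s : Bool} → Elem L → Elem (s ∷ L)
  shift (i , i∈L) = suc i , there i∈L

  shiftLiteral : {L : Subset n} {s : Bool} → Literal (Elem L) → Literal (Elem (s ∷ L))
  shiftLiteral (pos i) = pos (shift i)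
  shiftLiteral (neg i) = neg (shift i)

  restrict : {L : Subset n} → Cube (∁ L) → Partial n → Maybe (Term (Elem L))
  restrict {L = []}          []       []            = just []
  restrict {L = inside ∷ L}  (skip x) (nothing ∷ P) = Maybe.map (map shiftLiteral) (restrict x P)
  restrict {L = inside ∷ L}  (skip x) (just b ∷ P)  =
    Maybe.map (λ t → literal b (zero , here) ∷ map shiftLiteral t) (restrict x P)
  restrict {L = outside ∷ L} (c ∷ x)  (nothing ∷ P) = Maybe.map (map shiftLiteral) (restrict x P)
  restrict {L = outside ∷ L} (c ∷ x)  (just b ∷ P)  =
    if same b c then Maybe.map (map shiftLiteral) (restrict x P) else nothing

  restrict-length : {L : Subset n} (x : Cube (∁ L)) (P : Partial n) {t : Term (Elem L)} →
                    restrict x P ≡ just t → length t ≤ liveSize L P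
  restrict-length {L = []}          []       []            refl = z≤n
  restrict-length {L = inside ∷ L}  (skip x) (nothing ∷ P) e with restrict x P in e′
  restrict-length {L = inside ∷ L}  (skip x) (nothing ∷ P) refl | just t =
    ≤-trans (≤-reflexive (length-map _ t)) (restrict-length x P e′)
  restrict-length {L = inside ∷ L}  (skip x) (just b ∷ P)  e with restrict x P in e′
  restrict-length {L = inside ∷ L}  (skip x) (just b ∷ P)  refl | just t =
    s≤s (≤-trans (≤-reflexive (length-map _ t)) (restrict-length x P e′))
  restrict-length {L = outside ∷ L} (c ∷ x)  (nothing ∷ P) e with restrict x P in e′
  restrict-length {L = outside ∷ L} (c ∷ x)  (nothing ∷ P) refl | just t =
    ≤-trans (≤-reflexive (length-map _ t)) (restrict-length x P e′)
  restrict-length {L = outside ∷ L} (c ∷ x)  (just b ∷ P)  e with same b c | restrict x P in e′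
  restrict-length {L = outside ∷ L} (c ∷ x)  (just b ∷ P)  refl | true | just t =
    ≤-trans (≤-reflexive (length-map _ t)) (restrict-length x P e′)

  module _ {L : Subset n} {s : Bool} (a : Elem L → Bool) (a′ : Elem (s ∷ L) → Bool) (h : ∀ i → a′ (shift i) ≡ a i) where

    eval-shift : (t : Term (Elem L)) → evalTerm a′ (map shiftLiteral t) ≡ evalTerm a t
    eval-shift []          = refl
    eval-shift (pos i ∷ t) = cong₂ _∧_ (h i) (eval-shift t)
    eval-shift (neg i ∷ t) = cong₂ _∧_ (cong not (h i)) (eval-shift t)

    eval-shift-Maybe : (mt : Maybe (Term (Elem L))) →
      holds (evalTerm a′) (Maybe.map (map shiftLiteral) mt) ≡ holds (evalTerm a) mt
    eval-shift-Maybe (just t) = eval-shift t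
    eval-shift-Maybe nothing  = refl

  evalLiteral-literal : {V : Set} (a : V → Bool) (b : Bool) (v : V) → evalLiteral a (literal b v) ≡ same b (a v)
  evalLiteral-literal a true  v = refl
  evalLiteral-literal a false v = refl

  restrict-eval : {L : Subset n} (x : Cube (∁ L)) (y : Cube L) (P : Partial n) →
                  holds (evalTerm (coord y)) (restrict x P) ≡ (P ⊑ complete (merge x y))
  restrict-eval {L = []}          []       []       []            = refl
  restrict-eval {L = inside ∷ L}  (skip x) (d ∷ y)  (nothing ∷ P) =
    trans (eval-shift-Maybe (coord y) (coord (d ∷ y)) (λ _ → refl) (restrict x P)) (restrict-eval x y P)
  restrict-eval {L = inside ∷ L}  (skip x) (d ∷ y)  (just b ∷ P) with restrict x P | restrict-eval x y P
  ... | just t  | ih = cong₂ _∧_ (evalLiteral-literal (coord (d ∷ y)) b (zero , here))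
                                 (trans (eval-shift (coord y) (coord (d ∷ y)) (λ _ → refl) t) ih)
  ... | nothing | ih = trans (sym (∧-zeroʳ (same b d))) (cong (same b d ∧_) ih)
  restrict-eval {L = outside ∷ L} (c ∷ x)  (skip y) (nothing ∷ P) =
    trans (eval-shift-Maybe (coord y) (coord (skip y)) (λ _ → refl) (restrict x P)) (restrict-eval x y P)
  restrict-eval {L = outside ∷ L} (c ∷ x)  (skip y) (just b ∷ P) with same b c
  ... | true  = trans (eval-shift-Maybe (coord y) (coord (skip y)) (λ _ → refl) (restrict x P)) (restrict-eval x y P)
  ... | false = refl

  restrictAll : {L : Subset n} → Cube (∁ L) → List (Partial n) → DNF (Elem L)
  restrictAll x = mapMaybe (restrict x)

  restrictAll-eval : {L : Subset n} (x : Cube (∁ L)) (y : Cube L) (Ps : List (Partial n)) →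
                     ⟦ restrictAll x Ps ⟧ᴸ y ≡ hit Ps (complete (merge x y))
  restrictAll-eval x y []       = refl
  restrictAll-eval x y (P ∷ Ps) with restrict x P | restrict-eval x y P
  ... | just t  | e = cong₂ _∨_ e (restrictAll-eval x y Ps)
  ... | nothing | e rewrite sym e = restrictAll-eval x y Ps

  wide : ℕ → List (Partial n) → Subset n → Bool
  wide h Ps L = any (λ P → h <ᵇ liveSize L P) Ps

  restrictAll-width : {L : Subset n} (x : Cube (∁ L)) (h : ℕ) (Ps : List (Partial n)) →
                      wide h Ps L ≡ false → HasWidth h (restrictAll x Ps)
  restrictAll-width {L = L} x h []       e = []
  restrictAll-width {L = L} x h (P ∷ Ps) e with h <ᵇ liveSize L P in e₁ | restrict x P in e₂
  ... | false | just t  = ≤-trans (restrict-length x P e₂) (≮⇒≥ λ l → subst T e₁ (<⇒<ᵇ l)) ∷ restrictAll-width x h Ps e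
  ... | false | nothing = restrictAll-width x h Ps e

  subsetsOfSize : ℕ → Partial n → List (Subset n)
  subsetsOfSize zero    []            = [] ∷ []
  subsetsOfSize (suc h) []            = []
  subsetsOfSize h       (nothing ∷ P) = map (outside ∷_) (subsetsOfSize h P)
  subsetsOfSize zero    (just _ ∷ P)  = map (outside ∷_) (subsetsOfSize zero P)
  subsetsOfSize (suc h) (just _ ∷ P)  = map (outside ∷_) (subsetsOfSize (suc h) P) ++ map (inside ∷_) (subsetsOfSize h P)

  subsetsOfSize-size : (h : ℕ) (P : Partial n) → All (λ I → ∣ I ∣ ≡ h) (subsetsOfSize h P)
  subsetsOfSize-size zero    []            = refl ∷ []
  subsetsOfSize-size (suc h) []            = []
  subsetsOfSize-size zero    (nothing ∷ P) = map⁺ (subsetsOfSize-size zero P)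
  subsetsOfSize-size (suc h) (nothing ∷ P) = map⁺ (subsetsOfSize-size (suc h) P)
  subsetsOfSize-size zero    (just _ ∷ P)  = map⁺ (subsetsOfSize-size zero P)
  subsetsOfSize-size (suc h) (just _ ∷ P)  =
    All.++⁺ (map⁺ (subsetsOfSize-size (suc h) P)) (map⁺ (All.map (cong suc) (subsetsOfSize-size h P)))

  subsetsOfSize-length : (h : ℕ) (P : Partial n) → length (subsetsOfSize h P) ≤ 2 ^ size P
  subsetsOfSize-length zero    []            = ≤-refl
  subsetsOfSize-length (suc h) []            = z≤n
  subsetsOfSize-length zero    (nothing ∷ P) = ≤-trans (≤-reflexive (length-map _ (subsetsOfSize zero P))) (subsetsOfSize-length zero P)
  subsetsOfSize-length (suc h) (nothing ∷ P) = ≤-trans (≤-reflexive (length-map _ (subsetsOfSize (suc h) P))) (subsetsOfSize-length (suc h) P)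
  subsetsOfSize-length zero    (just _ ∷ P)  =
    ≤-trans (≤-reflexive (length-map _ (subsetsOfSize zero P))) (≤-trans (subsetsOfSize-length zero P) (m≤m+n _ _))
  subsetsOfSize-length (suc h) (just _ ∷ P)  = begin
    length (map (outside ∷_) (subsetsOfSize (suc h) P) ++ map (inside ∷_) (subsetsOfSize h P))
      ≡⟨ trans (length-++ (map (outside ∷_) (subsetsOfSize (suc h) P)))
           (cong₂ _+_ (length-map _ (subsetsOfSize (suc h) P)) (length-map _ (subsetsOfSize h P))) ⟩
    length (subsetsOfSize (suc h) P) + length (subsetsOfSize h P)
      ≤⟨ +-mono-≤ (subsetsOfSize-length (suc h) P) (subsetsOfSize-length h P) ⟩
    2 ^ size P + 2 ^ size P
      ≡⟨ cong (2 ^ size P +_) (+-identityʳ _) ⟨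
    2 * 2 ^ size P ∎
    where open ≤-Reasoning

  subsetsOfSize-∈ : (h : ℕ) (L : Subset n) (P : Partial n) → h ≤ liveSize L P →
                    ∃[ I ] I ∈ subsetsOfSize h P × I ⊆ L
  subsetsOfSize-∈ zero    []            []            _ = [] , here refl , λ ()
  subsetsOfSize-∈ (suc h) []            []            ()
  subsetsOfSize-∈ zero    (s ∷ L)       (nothing ∷ P) l with I , i , I⊆L ← subsetsOfSize-∈ zero L P l
    = outside ∷ I , ∈-map⁺ _ i , out⊆ I⊆L
  subsetsOfSize-∈ (suc h) (s ∷ L)       (nothing ∷ P) l with I , i , I⊆L ← subsetsOfSize-∈ (suc h) L P l
    = outside ∷ I , ∈-map⁺ _ i , out⊆ I⊆L
  subsetsOfSize-∈ zero    (s ∷ L)       (just _ ∷ P)  l with I , i , I⊆L ← subsetsOfSize-∈ zero L P z≤n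
    = outside ∷ I , ∈-map⁺ _ i , out⊆ I⊆L
  subsetsOfSize-∈ (suc h) (inside ∷ L)  (just _ ∷ P)  l with I , i , I⊆L ← subsetsOfSize-∈ h L P (s≤s⁻¹ l)
    = inside ∷ I , ∈-++⁺ʳ _ (∈-map⁺ _ i) , s⊆s I⊆L
  subsetsOfSize-∈ (suc h) (outside ∷ L) (just _ ∷ P)  l with I , i , I⊆L ← subsetsOfSize-∈ (suc h) L P l
    = outside ∷ I , ∈-++⁺ˡ (∈-map⁺ _ i) , out⊆ I⊆L

  wide-⊆ : (h : ℕ) (Ps : List (Partial n)) (L : Subset n) → T (wide h Ps L) →
           ∃[ I ] I ∈ concatMap (subsetsOfSize (suc h)) Ps × I ⊆ L
  wide-⊆ h (P ∷ Ps) L t with h <ᵇ liveSize L P in e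
  ... | true  with I , i , I⊆L ← subsetsOfSize-∈ (suc h) L P (<ᵇ⇒< h _ (subst T (sym e) tt))
    = I , ∈-++⁺ˡ i , I⊆L
  ... | false with I , i , I⊆L ← wide-⊆ h Ps L t
    = I , ∈-++⁺ʳ (subsetsOfSize (suc h) P) i , I⊆L

  n<2^n : ∀ n → n < 2 ^ n
  n<2^n zero    = s≤s z≤n
  n<2^n (suc n) = ≤-trans (+-mono-≤ (m^n>0 2 n) (n<2^n n)) (≤-reflexive (cong (2 ^ n +_) (sym (+-identityʳ (2 ^ n)))))

  w≤2⌊w/2⌋+1 : ∀ w → w ≤ suc (2 * ⌊ w /2⌋)
  w≤2⌊w/2⌋+1 zero          = z≤n
  w≤2⌊w/2⌋+1 (suc zero)    = ≤-refl
  w≤2⌊w/2⌋+1 (suc (suc w)) = s≤s (≤-trans (s≤s (w≤2⌊w/2⌋+1 w)) (≤-reflexive (lem ⌊ w /2⌋)))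
    where
    lem : ∀ h → 1 + (1 + 2 * h) ≡ 2 * (1 + h)
    lem = solve-∀

  ⌊w/2⌋<w : ∀ w → 0 < w → ⌊ w /2⌋ < w
  ⌊w/2⌋<w (suc w) _ = ⌊n/2⌋<n w

  rounds spreadness : ℕ → ℕ → ℕ
  rounds     w m = 16 * (w * w * m)
  spreadness w m = 6 * (rounds w m * w)

  rounds>0 : ∀ {w m} → 0 < w → 0 < m → 0 < rounds w m
  rounds>0 {suc w} {suc m} _ _ = s≤s z≤n

  2≤spreadness : ∀ {w m} → 0 < w → 0 < m → 2 ≤ spreadness w m
  2≤spreadness {suc w} {m} 0<w 0<m =
    ≤-trans (m≤m*n 2 3) (*-monoʳ-≤ 6 (*-mono-≤ (rounds>0 {suc w} {m} 0<w 0<m) 0<w))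

  enough-rounds : ∀ {w m} → 0 < w → 0 < m → let R = spreadness w m in
                  2 ^ m * 2 ^ m * (suc w * R ^ w) ≤ 2 ^ rounds w m
  enough-rounds {w@(suc a)} {m@(suc b)} _ _ = begin
    2 ^ m * 2 ^ m * (suc w * R ^ w)
      ≤⟨ *-monoʳ-≤ (2 ^ m * 2 ^ m) (*-mono-≤ (n<2^n w) (^-monoˡ-≤ w R≤)) ⟩
    2 ^ m * 2 ^ m * (2 ^ w * (2 ^ e) ^ w)
      ≡⟨ cong₂ _*_ (sym (^-distribˡ-+-* 2 m m)) (trans (cong (2 ^ w *_) (^-*-assoc 2 e w)) (sym (^-distribˡ-+-* 2 w (e * w)))) ⟩
    2 ^ (m + m) * 2 ^ (w + e * w)
      ≡⟨ ^-distribˡ-+-* 2 (m + m) (w + e * w) ⟨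
    2 ^ (m + m + (w + e * w))
      ≤⟨ ^-monoʳ-≤ 2 (≤-trans (m≤m+n _ (2 + 17 * a + 13 * b + 31 * (a * b) + 13 * (a * a) + 16 * (a * a * b))) (≤-reflexive (exponents a b))) ⟩
    2 ^ rounds w m ∎
    where
    open ≤-Reasoning
    R = spreadness w m
    e = 7 + (3 * w + m)
    R≤ : R ≤ 2 ^ e
    R≤ = begin
      R                                           ≡⟨ lem w m ⟩
      96 * (w * w * w * m)                        ≤⟨ *-mono-≤ (m≤m+n 96 32) (*-mono-≤ (*-mono-≤ (*-mono-≤ w≤ w≤) w≤) (<⇒≤ (n<2^n m))) ⟩
      2 ^ 7 * (2 ^ w * 2 ^ w * 2 ^ w * 2 ^ m)     ≡⟨ cong (λ t → 2 ^ 7 * (t * 2 ^ m)) (lem′ (2 ^ w)) ⟩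
      2 ^ 7 * ((2 ^ w) ^ 3 * 2 ^ m)               ≡⟨ cong (λ t → 2 ^ 7 * (t * 2 ^ m)) (trans (^-*-assoc 2 w 3) (cong (2 ^_) (*-comm w 3))) ⟩
      2 ^ 7 * (2 ^ (3 * w) * 2 ^ m)               ≡⟨ cong (2 ^ 7 *_) (^-distribˡ-+-* 2 (3 * w) m) ⟨
      2 ^ 7 * 2 ^ (3 * w + m)                     ≡⟨ ^-distribˡ-+-* 2 7 (3 * w + m) ⟨
      2 ^ e                                       ∎
      where
      w≤ = <⇒≤ (n<2^n w)
      lem : ∀ w m → 6 * (16 * (w * w * m) * w) ≡ 96 * (w * w * w * m)
      lem = solve-∀
      lem′ : ∀ x → x * x * x ≡ x * (x * (x * 1))
      lem′ = solve-∀
    exponents : ∀ a b →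
      1 + b + (1 + b) + (1 + a + (7 + (3 * (1 + a) + (1 + b))) * (1 + a)) +
      (2 + 17 * a + 13 * b + 31 * (a * b) + 13 * (a * a) + 16 * (a * a * b)) ≡
      16 * ((1 + a) * (1 + a) * (1 + b))
    exponents = solve-∀

  few-subsets : ∀ {w} R h N → 0 < w → 0 < R → w ≤ 2 * h → N ≤ 2 * (suc w * R ^ w) * 2 ^ w →
                2 * N ≤ ((16 * R) ^ 2) ^ h
  few-subsets {w@(suc a)} R h N _ 0<R w≤2h bound = begin
    2 * N                                    ≤⟨ *-monoʳ-≤ 2 bound ⟩
    2 * (2 * (suc w * R ^ w) * 2 ^ w)        ≡⟨ lem (suc w) (R ^ w) (2 ^ w) ⟩
    4 * (suc w * (2 ^ w * R ^ w))            ≤⟨ *-mono-≤ (m≤m*n 4 (4 ^ a) {{m^n≢0 4 a}}) (*-monoˡ-≤ (2 ^ w * R ^ w) (n<2^n w)) ⟩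
    4 ^ w * (2 ^ w * (2 ^ w * R ^ w))        ≡⟨ cong (λ t → 4 ^ w * (2 ^ w * t)) (^-distribʳ-* 2 R w) ⟨
    4 ^ w * (2 ^ w * (2 * R) ^ w)            ≡⟨ cong (4 ^ w *_) (^-distribʳ-* 2 (2 * R) w) ⟨
    4 ^ w * (2 * (2 * R)) ^ w                ≡⟨ ^-distribʳ-* 4 (2 * (2 * R)) w ⟨
    (4 * (2 * (2 * R))) ^ w                  ≡⟨ cong (_^ w) (lem′ R) ⟩
    (16 * R) ^ w                             ≤⟨ ^-monoʳ-≤ (16 * R) {{m*n≢0 16 R {{_}} {{>-nonZero 0<R}}}} w≤2h ⟩
    (16 * R) ^ (2 * h)                       ≡⟨ ^-*-assoc (16 * R) 2 h ⟨
    ((16 * R) ^ 2) ^ h                       ∎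
    where
    open ≤-Reasoning
    lem : ∀ a b c → 2 * (2 * (a * b) * c) ≡ 4 * (a * (c * b))
    lem = solve-∀
    lem′ : ∀ R → 4 * (2 * (2 * R)) ≡ 16 * R
    lem′ = solve-∀

  mass-∅ : ∀ n → mass 0 (∅ n) ≡ 2 ^ n
  mass-∅ zero    = refl
  mass-∅ (suc n) = trans (mass-nothing 0 (∅ n)) (cong (2 *_) (mass-∅ n))

  length-points-≤ : (L : Subset n) → length (points L) ≤ 2 ^ n
  length-points-≤ {n} L = ≤-trans (m≤n*m (length (points L)) (length (points (∁ L))) {{>-nonZero (points-nonempty (∁ L))}})
                            (≤-reflexive (trans (length-points L) (mass-∅ n)))

  T⇒≤ : ∀ {a b} → (T a → T b) → a Bool.≤ b
  T⇒≤ {false} {false} h = Bool.b≤b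
  T⇒≤ {false} {true}  h = Bool.f≤t
  T⇒≤ {true}  {true}  h = Bool.b≤b
  T⇒≤ {true}  {false} h = ⊥-elim (h tt)

  ind-xorˡ : ∀ {a b c} → (T a → T b) → (T b → T c) → ind (a xor b) ℕ.≤ ind (c ∧ not a)
  ind-xorˡ {true}  {true}          h k = z≤n
  ind-xorˡ {true}  {false}         h k = ⊥-elim (h tt)
  ind-xorˡ {false} {false}         h k = z≤n
  ind-xorˡ {false} {true}  {true}  h k = ≤-refl
  ind-xorˡ {false} {true}  {false} h k = ⊥-elim (k tt)

  ind-xorʳ : ∀ {a b c} → (T a → T b) → (T b → T c) → ind (c xor b) ℕ.≤ ind (c ∧ not a)
  ind-xorʳ {_}     {true}  {true}  h k = z≤n
  ind-xorʳ {_}     {true}  {false} h k = ⊥-elim (k tt)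
  ind-xorʳ {true}  {false} {_}     h k = ⊥-elim (h tt)
  ind-xorʳ {false} {false} {true}  h k = ≤-refl
  ind-xorʳ {false} {false} {false} h k = z≤n

open Counting

module RealFacts (R : Reals) where

  open Reals R
  open CommutativeRing commutativeRing public
    using (refl; sym; trans; +-cong; +-congˡ; +-congʳ; *-cong; *-congˡ; *-congʳ;
           +-assoc; +-comm; +-identityˡ; +-identityʳ; *-assoc; *-comm; *-identityˡ; *-identityʳ;
           distribˡ; distribʳ; zeroˡ; zeroʳ; -‿inverseʳ)
  open IsDecTotalOrder isDecTotalOrder public
    using (total; antisym)
    renaming (reflexive to ≤-reflexive; refl to ≤-refl; trans to ≤-trans)
  open Algebra.Properties.CommutativeSemiring.Exp (CommutativeRing.commutativeSemiring commutativeRing) public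
    using (^-congˡ; ^-distrib-*)

  poset : Poset _ _ _
  poset = record { isPartialOrder = IsDecTotalOrder.isPartialOrder isDecTotalOrder }

  module ≤-Reasoning = Relation.Binary.Reasoning.PartialOrder poset
  module Solver = Algebra.Solver.Ring.NaturalCoefficients.Default (CommutativeRing.commutativeSemiring commutativeRing)
  private
    module Mult = Algebra.Properties.Semiring.Mult (CommutativeRing.semiring commutativeRing)

  0≤1 : 0# ≤ 1#
  0≤1 = proj₁ 0<1

  +-monoˡ-≤ : ∀ x {y z} → y ≤ z → y + x ≤ z + x
  +-monoˡ-≤ x {y} {z} h = ≤-trans (≤-reflexive (+-comm y x)) (≤-trans (+-monoʳ-≤ x h) (≤-reflexive (+-comm x z)))

  +-mono-≤ : ∀ {x y u v} → x ≤ y → u ≤ v → x + u ≤ y + v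
  +-mono-≤ {y = y} {u} h k = ≤-trans (+-monoˡ-≤ u h) (+-monoʳ-≤ y k)

  x≤x+y : ∀ x {y} → 0# ≤ y → x ≤ x + y
  x≤x+y x h = ≤-trans (≤-reflexive (sym (+-identityʳ x))) (+-monoʳ-≤ x h)

  +-nonneg : ∀ {x y} → 0# ≤ x → 0# ≤ y → 0# ≤ x + y
  +-nonneg {x} h k = ≤-trans h (x≤x+y x k)

  x+[y-x]≈y : ∀ x y → x + (y - x) ≈ y
  x+[y-x]≈y x y = trans (+-congˡ (+-comm y (- x))) (trans (sym (+-assoc x (- x) y)) (trans (+-congʳ (-‿inverseʳ x)) (+-identityˡ y)))

  0≤y-x : ∀ {x y} → x ≤ y → 0# ≤ y - x
  0≤y-x {x} h = ≤-trans (≤-reflexive (sym (-‿inverseʳ x))) (+-monoˡ-≤ (- x) h)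

  x≤y+z⇒x-z≤y : ∀ {x y z} → x ≤ y + z → x - z ≤ y
  x≤y+z⇒x-z≤y {x} {y} {z} h = ≤-trans (+-monoˡ-≤ (- z) h)
    (≤-reflexive (trans (+-assoc y z (- z)) (trans (+-congˡ (-‿inverseʳ z)) (+-identityʳ y))))

  *-monoʳ-≤ : ∀ {x y z} → 0# ≤ x → y ≤ z → x * y ≤ x * z
  *-monoʳ-≤ {x} {y} {z} 0≤x h = ≤-trans (x≤x+y (x * y) (*-nonneg 0≤x (0≤y-x h)))
    (≤-reflexive (trans (sym (distribˡ x y (z - y))) (*-congˡ (x+[y-x]≈y y z))))

  *-monoˡ-≤ : ∀ {x y z} → 0# ≤ x → y ≤ z → y * x ≤ z * x
  *-monoˡ-≤ {x} {y} {z} 0≤x h = ≤-trans (≤-reflexive (*-comm y x)) (≤-trans (*-monoʳ-≤ 0≤x h) (≤-reflexive (*-comm x z)))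

  *-mono-≤ : ∀ {x y u v} → 0# ≤ u → 0# ≤ y → x ≤ y → u ≤ v → x * u ≤ y * v
  *-mono-≤ 0≤u 0≤y h k = ≤-trans (*-monoˡ-≤ 0≤u h) (*-monoʳ-≤ 0≤y k)

  ^-nonneg : ∀ {x} n → 0# ≤ x → 0# ≤ x ^ n
  ^-nonneg zero    h = 0≤1
  ^-nonneg (suc n) h = *-nonneg h (^-nonneg n h)

  ^-mono-≤ : ∀ {x y} n → 0# ≤ x → x ≤ y → x ^ n ≤ y ^ n
  ^-mono-≤ zero    0≤x h = ≤-refl
  ^-mono-≤ (suc n) 0≤x h = *-mono-≤ (^-nonneg n 0≤x) (≤-trans 0≤x h) h (^-mono-≤ n 0≤x h)

  1≰0 : ¬ (1# ≤ 0#)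
  1≰0 h = proj₂ 0<1 (antisym 0≤1 h)

  <-≤-trans : ∀ {x y z} → x < y → y ≤ z → x < z
  <-≤-trans (x≤y , x≉y) y≤z = ≤-trans x≤y y≤z ,
    λ x≈z → x≉y (antisym x≤y (≤-trans y≤z (≤-reflexive (sym x≈z))))

  ⁻¹-inverseʳ : ∀ {x} → 0# < x → x * x ⁻¹ ≈ 1#
  ⁻¹-inverseʳ (_ , 0≉x) = ⁻¹-inverse λ x≈0 → 0≉x (sym x≈0)

  ⁻¹-nonneg : ∀ {x} → 0# < x → 0# ≤ x ⁻¹
  ⁻¹-nonneg {x} 0<x with total 0# (x ⁻¹)
  ... | inj₁ h = h
  ... | inj₂ h = ⊥-elim (1≰0 (≤-trans (≤-reflexive (sym (⁻¹-inverseʳ 0<x)))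
                   (≤-trans (*-monoʳ-≤ (proj₁ 0<x) h) (≤-reflexive (zeroʳ x)))))

  x*y*x⁻¹≈y : ∀ {x} y → 0# < x → y * x * x ⁻¹ ≈ y
  x*y*x⁻¹≈y {x} y 0<x = trans (*-assoc y x (x ⁻¹)) (trans (*-congˡ (⁻¹-inverseʳ 0<x)) (*-identityʳ y))

  y/x*x≈y : ∀ {x} y → 0# < x → y / x * x ≈ y
  y/x*x≈y {x} y 0<x = trans (*-assoc y (x ⁻¹) x) (trans (*-congˡ (trans (*-comm (x ⁻¹) x) (⁻¹-inverseʳ 0<x))) (*-identityʳ y))

  x≤y*z⇒x/z≤y : ∀ {x y z} → 0# < z → x ≤ y * z → x / z ≤ y
  x≤y*z⇒x/z≤y {y = y} 0<z h = ≤-trans (*-monoˡ-≤ (⁻¹-nonneg 0<z) h) (≤-reflexive (x*y*x⁻¹≈y y 0<z))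

  x*z≤y⇒x≤y/z : ∀ {x y z} → 0# < z → x * z ≤ y → x ≤ y / z
  x*z≤y⇒x≤y/z {x} 0<z h = ≤-trans (≤-reflexive (sym (x*y*x⁻¹≈y x 0<z))) (*-monoˡ-≤ (⁻¹-nonneg 0<z) h)

  x≤y/z⇒x*z≤y : ∀ {x y z} → 0# < z → x ≤ y / z → x * z ≤ y
  x≤y/z⇒x*z≤y {y = y} 0<z h = ≤-trans (*-monoˡ-≤ (proj₁ 0<z) h) (≤-reflexive (y/x*x≈y y 0<z))

  *-cancelʳ-≤ : ∀ {x y z} → 0# < z → x * z ≤ y * z → x ≤ y
  *-cancelʳ-≤ {x} {y} 0<z h = ≤-trans (x*z≤y⇒x≤y/z 0<z h) (≤-reflexive (x*y*x⁻¹≈y y 0<z))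

  *-pos : ∀ {x y} → 0# < x → 0# < y → 0# < x * y
  *-pos {x} {y} 0<x 0<y = *-nonneg (proj₁ 0<x) (proj₁ 0<y) , λ 0≈xy → proj₂ 0<x
    (antisym (proj₁ 0<x) (*-cancelʳ-≤ 0<y (≤-reflexive (trans (sym 0≈xy) (sym (zeroˡ y))))))

  ^-pos : ∀ {x} n → 0# < x → 0# < x ^ n
  ^-pos zero    h = 0<1
  ^-pos (suc n) h = *-pos h (^-pos n h)

  ⁻¹-pos : ∀ {x} → 0# < x → 0# < x ⁻¹
  ⁻¹-pos {x} 0<x = ⁻¹-nonneg 0<x , λ 0≈x⁻¹ → proj₂ 0<1
    (trans (sym (zeroʳ x)) (trans (*-congˡ 0≈x⁻¹) (⁻¹-inverseʳ 0<x)))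

  fromℕ-+ : ∀ a b → fromℕ (a ℕ.+ b) ≈ fromℕ a + fromℕ b
  fromℕ-+ a b = Mult.×-homo-+ 1# a b

  fromℕ-* : ∀ a b → fromℕ (a ℕ.* b) ≈ fromℕ a * fromℕ b
  fromℕ-* = Mult.×1-homo-*

  fromℕ-1 : fromℕ 1 ≈ 1#
  fromℕ-1 = +-identityʳ 1#

  fromℕ-suc-* : ∀ k x → fromℕ (suc k) * x ≈ x + fromℕ k * x
  fromℕ-suc-* k x = trans (distribʳ x 1# (fromℕ k)) (+-congʳ (*-identityˡ x))

  fromℕ-^ : ∀ a k → fromℕ (a ℕ.^ k) ≈ fromℕ a ^ k
  fromℕ-^ a zero    = fromℕ-1
  fromℕ-^ a (suc k) = trans (fromℕ-* a (a ℕ.^ k)) (*-congˡ (fromℕ-^ a k))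

  fromℕ-nonneg : ∀ a → 0# ≤ fromℕ a
  fromℕ-nonneg zero    = ≤-refl
  fromℕ-nonneg (suc a) = +-nonneg 0≤1 (fromℕ-nonneg a)

  fromℕ-mono : ∀ {a b} → a ℕ.≤ b → fromℕ a ≤ fromℕ b
  fromℕ-mono {b = b} ℕ.z≤n = fromℕ-nonneg b
  fromℕ-mono (ℕ.s≤s h) = +-monoʳ-≤ 1# (fromℕ-mono h)

  fromℕ-cong : ∀ {a b} → a ≡.≡ b → fromℕ a ≈ fromℕ b
  fromℕ-cong ≡.refl = refl

  fromℕ≥1 : ∀ {a} → 0 ℕ.< a → 1# ≤ fromℕ a
  fromℕ≥1 h = ≤-trans (≤-reflexive (sym fromℕ-1)) (fromℕ-mono h)

  fromℕ-pos : ∀ a → 0 ℕ.< a → 0# < fromℕ a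
  fromℕ-pos a h = <-≤-trans 0<1 (fromℕ≥1 h)

  2^-cong : ∀ {x y} → x ≈ y → 2^ x ≈ 2^ y
  2^-cong h = antisym (2^-mono-≤ (≤-reflexive h)) (2^-mono-≤ (≤-reflexive (sym h)))

  0<2 : 0# < 1# + 1#
  0<2 = <-≤-trans 0<1 (x≤x+y 1# 0≤1)

  2^-0 : 2^ 0# ≈ 1#
  2^-0 = antisym (*-cancelʳ-≤ 0<2 (≤-reflexive eq)) (*-cancelʳ-≤ 0<2 (≤-reflexive (sym eq)))
    where
    eq : 2^ 0# * (1# + 1#) ≈ 1# * (1# + 1#)
    eq = trans (*-congˡ (sym 2^-1)) (trans (sym (2^-+ 0# 1#))
           (trans (2^-cong (+-identityˡ 1#)) (trans 2^-1 (sym (*-identityˡ _)))))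

  2^-fromℕ* : ∀ k x → 2^ (fromℕ k * x) ≈ 2^ x ^ k
  2^-fromℕ* zero    x = trans (2^-cong (zeroˡ x)) 2^-0
  2^-fromℕ* (suc k) x = trans (2^-cong (fromℕ-suc-* k x))
                              (trans (2^-+ x (fromℕ k * x)) (*-congˡ (2^-fromℕ* k x)))

  2^-fromℕ : ∀ k → 2^ (fromℕ k) ≈ fromℕ (2 ℕ.^ k)
  2^-fromℕ k = trans (2^-cong (sym (*-identityʳ (fromℕ k)))) (trans (2^-fromℕ* k 1#)
    (trans (^-congˡ k (trans 2^-1 (+-congˡ (sym fromℕ-1)))) (sym (fromℕ-^ 2 k))))

  module _ {A : Set} where

    sumOver-mono : (xs : List A) {f g : A → ℝ} → (∀ x → f x ≤ g x) → sumOver xs f ≤ sumOver xs g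
    sumOver-mono []       h = ≤-refl
    sumOver-mono (x ∷ xs) h = +-mono-≤ (h x) (sumOver-mono xs h)

    sumOver-0 : (xs : List A) → sumOver xs (λ _ → 0#) ≈ 0#
    sumOver-0 []       = refl
    sumOver-0 (x ∷ xs) = trans (+-identityˡ _) (sumOver-0 xs)

    sumOver-nonneg : (xs : List A) {f : A → ℝ} → (∀ x → 0# ≤ f x) → 0# ≤ sumOver xs f
    sumOver-nonneg []       h = ≤-refl
    sumOver-nonneg (x ∷ xs) h = +-nonneg (h x) (sumOver-nonneg xs h)

    sumOver-+ : (xs : List A) (f g : A → ℝ) → sumOver xs (λ x → f x + g x) ≈ sumOver xs f + sumOver xs g
    sumOver-+ []       f g = sym (+-identityˡ 0#)
    sumOver-+ (x ∷ xs) f g = trans (+-congˡ (sumOver-+ xs f g))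
      (solve 4 (λ a b c d → (a :+ b) :+ (c :+ d) := (a :+ c) :+ (b :+ d)) refl (f x) (g x) _ _)
      where open Solver

    sumOver-*ʳ : (xs : List A) (f : A → ℝ) (c : ℝ) → sumOver xs (λ x → f x * c) ≈ sumOver xs f * c
    sumOver-*ʳ []       f c = sym (zeroˡ c)
    sumOver-*ʳ (x ∷ xs) f c = trans (+-congˡ (sumOver-*ʳ xs f c)) (sym (distribʳ c (f x) _))

    sumOver-≤-const : {xs : List A} {f : A → ℝ} {c : ℝ} → All (λ x → f x ≤ c) xs → sumOver xs f ≤ fromℕ (length xs) * c
    sumOver-≤-const {c = c} [] = ≤-reflexive (sym (zeroˡ c))
    sumOver-≤-const {c = c} (_∷_ {xs = xs} h hs) = ≤-trans (+-mono-≤ h (sumOver-≤-const hs))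
      (≤-reflexive (sym (fromℕ-suc-* (length xs) c)))

  sumOver-swap : {A B : Set} (xs : List A) (ys : List B) (f : A → B → ℝ) →
                 sumOver xs (λ x → sumOver ys (f x)) ≈ sumOver ys (λ y → sumOver xs (λ x → f x y))
  sumOver-swap []       ys f = sym (sumOver-0 ys)
  sumOver-swap (x ∷ xs) ys f = trans (+-congˡ (sumOver-swap xs ys f)) (sym (sumOver-+ ys (f x) _))

module Proof (R : Reals) where
  open Reals R
  open Probability R
  open RealFacts R

  private variable
    n : ℕ

  *-antimonoˡ-≤ : ∀ {x y z} → z ≤ 0# → x ≤ y → y * z ≤ x * z
  *-antimonoˡ-≤ {x} {y} {z} z≤0 x≤y = begin
    y * z                      ≈⟨ *-congʳ (x+[y-x]≈y x y) ⟨
    (x + (y - x)) * z          ≈⟨ distribʳ z x (y - x) ⟩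
    x * z + (y - x) * z        ≤⟨ +-monoʳ-≤ (x * z) (*-monoʳ-≤ (0≤y-x x≤y) z≤0) ⟩
    x * z + (y - x) * 0#       ≈⟨ trans (+-congˡ (zeroʳ (y - x))) (+-identityʳ (x * z)) ⟩
    x * z                      ∎
    where open ≤-Reasoning

  module _ {δ s : ℝ} {w : ℕ} (0<s : 0# < s) (0<w : 0 ℕ.< w) where

    1≤**-of-log≥0 : 0# ≤ log δ → 1# ≤ δ ** (s / fromℕ 4)
    1≤**-of-log≥0 0≤l = ≤-trans (≤-reflexive (sym 2^-0))
      (2^-mono-≤ (*-nonneg (*-nonneg (proj₁ 0<s) (⁻¹-nonneg (fromℕ-pos 4 (s≤s z≤n)))) 0≤l))

    **-^-≤ : log δ ≤ 0# → ∀ h → w ℕ.≤ 2 ℕ.* h → (δ ** (s / (fromℕ 2 * fromℕ w))) ^ h ≤ δ ** (s / fromℕ 4)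
    **-^-≤ l≤0 h w≤2h = begin
      (δ ** t) ^ h                      ≈⟨ 2^-fromℕ* h (t * log δ) ⟨
      2^ (fromℕ h * (t * log δ))        ≈⟨ 2^-cong (sym (*-assoc (fromℕ h) t (log δ))) ⟩
      2^ (fromℕ h * t * log δ)          ≤⟨ 2^-mono-≤ (*-antimonoˡ-≤ l≤0 (x≤y*z⇒x/z≤y (fromℕ-pos 4 (s≤s z≤n)) s≤)) ⟩
      δ ** (s / fromℕ 4)                ∎
      where
      open ≤-Reasoning
      t = s / (fromℕ 2 * fromℕ w)
      0<2w : 0# < fromℕ 2 * fromℕ w
      0<2w = *-pos (fromℕ-pos 2 (s≤s z≤n)) (fromℕ-pos w 0<w)
      lem : ∀ h → 2 ℕ.* (2 ℕ.* h) ≡ h ℕ.* 4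
      lem = solve-∀
      s≤ : s ≤ fromℕ h * t * fromℕ 4
      s≤ = begin
        s                                ≈⟨ y/x*x≈y s 0<2w ⟨
        t * (fromℕ 2 * fromℕ w)          ≈⟨ *-congˡ (fromℕ-* 2 w) ⟨
        t * fromℕ (2 ℕ.* w)              ≤⟨ *-monoʳ-≤ (*-nonneg (proj₁ 0<s) (⁻¹-nonneg 0<2w))
                                              (fromℕ-mono (ℕ.≤-trans (ℕ.*-monoʳ-≤ 2 w≤2h) (ℕ.≤-reflexive (lem h)))) ⟩
        t * fromℕ (h ℕ.* 4)              ≈⟨ *-congˡ (fromℕ-* h 4) ⟩
        t * (fromℕ h * fromℕ 4)          ≈⟨ sym (*-assoc t (fromℕ h) (fromℕ 4)) ⟩
        t * fromℕ h * fromℕ 4            ≈⟨ *-congʳ (*-comm t (fromℕ h)) ⟩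
        fromℕ h * t * fromℕ 4            ∎

  module _ {ε : ℝ} (0<ε : 0# < ε) (ε≤½ : ε ≤ 1# / fromℕ 2) where
    private
      λₑ = log (1# / ε)

      0<1/ε : 0# < 1# / ε
      0<1/ε = *-pos 0<1 (⁻¹-pos 0<ε)

      2≤1/ε : fromℕ 2 ≤ 1# / ε
      2≤1/ε = x*z≤y⇒x≤y/z 0<ε (≤-trans (≤-reflexive (*-comm (fromℕ 2) ε)) (x≤y/z⇒x*z≤y (fromℕ-pos 2 (s≤s z≤n)) ε≤½))

    1≤2log : 1# ≤ λₑ + λₑ
    1≤2log with total 1# (λₑ + λₑ)
    ... | inj₁ h = h
    ... | inj₂ h = ⊥-elim (1≰0 (≤-trans (≤-reflexive 1≈2-1) (x≤y+z⇒x-z≤y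
                     (≤-trans (*-cancelʳ-≤ (fromℕ-pos 2 (s≤s z≤n)) 2*2≤1*2) (≤-reflexive (sym (+-identityˡ 1#)))))))
      where
      open ≤-Reasoning
      1≈2-1 : 1# ≈ fromℕ 2 - 1#
      1≈2-1 = sym (trans (+-congʳ (+-comm 1# (fromℕ 1))) (trans (+-assoc (fromℕ 1) 1# (- 1#))
                (trans (+-congˡ (-‿inverseʳ 1#)) (trans (+-identityʳ (fromℕ 1)) fromℕ-1))))
      2*2≤1*2 : fromℕ 2 * fromℕ 2 ≤ 1# * fromℕ 2
      2*2≤1*2 = begin
        fromℕ 2 * fromℕ 2          ≤⟨ *-mono-≤ (fromℕ-nonneg 2) (proj₁ 0<1/ε) 2≤1/ε 2≤1/ε ⟩
        1# / ε * (1# / ε)          ≈⟨ *-cong (2^-log 0<1/ε) (2^-log 0<1/ε) ⟨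
        2^ λₑ * 2^ λₑ              ≈⟨ 2^-+ λₑ λₑ ⟨
        2^ (λₑ + λₑ)               ≤⟨ 2^-mono-≤ h ⟩
        2^ 1#                      ≈⟨ 2^-1 ⟩
        1# + 1#                    ≈⟨ +-congˡ (sym fromℕ-1) ⟩
        fromℕ 2                    ≈⟨ *-identityˡ _ ⟨
        1# * fromℕ 2               ∎

    0<log : 0# < λₑ
    0<log with total λₑ 0#
    ... | inj₁ h = ⊥-elim (1≰0 (≤-trans 1≤2log (≤-trans (+-mono-≤ h h) (≤-reflexive (+-identityˡ 0#)))))
    ... | inj₂ h = h , λ 0≈λ → 1≰0 (≤-trans 1≤2log (≤-reflexive (trans (+-cong (sym 0≈λ) (sym 0≈λ)) (+-identityˡ 0#))))

    -- Completeness yields the Archimedean property only up to double negation,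
    -- so the search for the ceiling of log (1/ε) is cut off at n + 1.  This
    -- suffices: a multiple of 2^(n+1) that is at most 2^n vanishes.
    Ceiling : ℕ → ℕ → Set
    Ceiling n m = 0 ℕ.< m × fromℕ m ≤ 1# + λₑ × (λₑ ≤ fromℕ m ⊎ n ℕ.< m)

    search : ∀ N → (∃[ m ] 0 ℕ.< m × fromℕ m ≤ 1# + λₑ × λₑ ≤ fromℕ m) ⊎ fromℕ N ≤ λₑ
    search zero    = inj₂ (proj₁ 0<log)
    search (suc N) with search N
    ... | inj₁ found = inj₁ found
    ... | inj₂ N≤λ with total λₑ (fromℕ (suc N))
    ...   | inj₁ h = inj₁ (suc N , s≤s z≤n , +-monoʳ-≤ 1# N≤λ , h)
    ...   | inj₂ h = inj₂ h

    ceiling : ∀ n → ∃[ m ] Ceiling n m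
    ceiling n with search (suc n)
    ... | inj₁ (m , 0<m , ub , lb) = m , 0<m , ub , inj₁ lb
    ... | inj₂ h = suc n , s≤s z≤n , ≤-trans h (≤-trans (x≤x+y λₑ 0≤1) (≤-reflexive (+-comm λₑ 1#))) , inj₂ ℕ.≤-refl

    fraction-≤ε : ∀ {n m} → Ceiling n m → ∀ {a N} → 2 ℕ.^ m ℕ.* a ℕ.≤ N → 0 ℕ.< N → N ℕ.≤ 2 ℕ.^ n →
                  fromℕ a / fromℕ N ≤ ε
    fraction-≤ε {n} {m} (_ , _ , inj₁ λ≤m) {a} {N} h 0<N _ = x≤y*z⇒x/z≤y (fromℕ-pos N 0<N) (begin
      fromℕ a                              ≈⟨ *-identityˡ (fromℕ a) ⟨
      1# * fromℕ a                         ≈⟨ *-congʳ (y/x*x≈y 1# 0<ε) ⟨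
      1# / ε * ε * fromℕ a                 ≤⟨ *-monoˡ-≤ (fromℕ-nonneg a) (*-monoˡ-≤ (proj₁ 0<ε) 1/ε≤2^m) ⟩
      fromℕ (2 ℕ.^ m) * ε * fromℕ a        ≈⟨ trans (*-congʳ (*-comm _ ε)) (*-assoc ε _ (fromℕ a)) ⟩
      ε * (fromℕ (2 ℕ.^ m) * fromℕ a)      ≈⟨ *-congˡ (fromℕ-* (2 ℕ.^ m) a) ⟨
      ε * fromℕ (2 ℕ.^ m ℕ.* a)            ≤⟨ *-monoʳ-≤ (proj₁ 0<ε) (fromℕ-mono h) ⟩
      ε * fromℕ N                          ∎)
      where
      open ≤-Reasoning
      1/ε≤2^m : 1# / ε ≤ fromℕ (2 ℕ.^ m)
      1/ε≤2^m = ≤-trans (≤-reflexive (sym (2^-log 0<1/ε))) (≤-trans (2^-mono-≤ λ≤m) (≤-reflexive (2^-fromℕ m)))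
    fraction-≤ε (_ , _ , inj₂ n<m) {zero} {N} h 0<N N≤ =
      x≤y*z⇒x/z≤y (fromℕ-pos N 0<N) (*-nonneg (proj₁ 0<ε) (fromℕ-nonneg N))
    fraction-≤ε {n} {m} (_ , _ , inj₂ n<m) {suc a} {N} h 0<N N≤ = ⊥-elim (ℕ.<-irrefl ≡.refl (begin-strict
      2 ℕ.^ n              <⟨ ℕ.^-monoʳ-< 2 (s≤s (s≤s z≤n)) n<m ⟩
      2 ℕ.^ m              ≤⟨ ℕ.m≤m*n (2 ℕ.^ m) (suc a) ⟩
      2 ℕ.^ m ℕ.* suc a    ≤⟨ h ⟩
      N                    ≤⟨ N≤ ⟩
      2 ℕ.^ n              ∎))
      where open ℕ.≤-Reasoning

    fromℕ-≤3log : ∀ m → fromℕ m ≤ 1# + λₑ → fromℕ m ≤ fromℕ 3 * λₑ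
    fromℕ-≤3log m h = begin
      fromℕ m               ≤⟨ h ⟩
      1# + λₑ               ≤⟨ +-monoˡ-≤ λₑ 1≤2log ⟩
      λₑ + λₑ + λₑ          ≈⟨ +-assoc λₑ λₑ λₑ ⟩
      λₑ + (λₑ + λₑ)        ≈⟨ +-congˡ (+-congˡ (trans (sym (*-identityˡ λₑ)) (*-congʳ (sym fromℕ-1)))) ⟩
      λₑ + (λₑ + fromℕ 1 * λₑ) ≈⟨ +-congˡ (fromℕ-suc-* 1 λₑ) ⟨
      λₑ + fromℕ 2 * λₑ     ≈⟨ fromℕ-suc-* 2 λₑ ⟨
      fromℕ 3 * λₑ          ∎
      where
      open ≤-Reasoning

  points-pos : (L : Subset n) → 0# < fromℕ (length (points L))
  points-pos L = fromℕ-pos (length (points L)) (points-nonempty L)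

  Pr-uniform-nonneg : (L : Subset n) (E : Cube L → Bool) → 0# ≤ Pr-uniform E
  Pr-uniform-nonneg L E = *-nonneg (fromℕ-nonneg (length (filterᵇ E (points L)))) (⁻¹-nonneg (points-pos L))

  Pr-uniform-not : {L : Subset n} (E : Cube L → Bool) → Pr-uniform (not ∘ E) + Pr-uniform E ≈ 1#
  Pr-uniform-not {L = L} E = begin-equality
    fromℕ a / fromℕ N + fromℕ b / fromℕ N     ≈⟨ distribʳ (fromℕ N ⁻¹) (fromℕ a) (fromℕ b) ⟨
    (fromℕ a + fromℕ b) / fromℕ N             ≈⟨ *-congʳ (fromℕ-+ a b) ⟨
    fromℕ (a ℕ.+ b) / fromℕ N                 ≈⟨ *-congʳ (fromℕ-cong (≡.trans (ℕ.+-comm a b) (length-filterᵇ-not E (points L)))) ⟩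
    fromℕ N / fromℕ N                         ≈⟨ ⁻¹-inverseʳ (points-pos L) ⟩
    1#                                        ∎
    where
    open ≤-Reasoning
    N = length (points L)
    a = length (filterᵇ (not ∘ E) (points L))
    b = length (filterᵇ E (points L))

  Pr-restriction-nonneg : (D : Distribution n) (E : Restriction n → Bool) → 0# ≤ Pr-restriction D E
  Pr-restriction-nonneg {n} D E = sumOver-nonneg (subsets n) λ L → *-nonneg (weight-≥0 D L) (Pr-uniform-nonneg (∁ L) (λ x → E ρ[ L , x ]))

  if-nonneg : ∀ b {x} → 0# ≤ x → 0# ≤ (if b then x else 0#)
  if-nonneg true  h = h
  if-nonneg false h = ≤-refl

  module _ (D : Distribution n) where

    Pr-subset-nonneg : (E : Subset n → Bool) → 0# ≤ Pr-subset D E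
    Pr-subset-nonneg E = sumOver-nonneg (subsets n) λ L → if-nonneg (E L) (weight-≥0 D L)

    union-bound : (E : Subset n → Bool) (Is : List (Subset n)) (q : ℝ) →
                  (∀ L → T (E L) → ∃[ I ] I ∈ Is × I ⊆ L) →
                  All (λ I → Pr-subset D (λ L → does (I ⊆? L)) ≤ q) Is →
                  Pr-subset D E ≤ fromℕ (length Is) * q
    union-bound E Is q cover small = begin
      sumOver (subsets n) (λ L → if E L then weight D L else 0#)
        ≤⟨ sumOver-mono (subsets n) pointwise ⟩
      sumOver (subsets n) (λ L → sumOver Is (λ I → if does (I ⊆? L) then weight D L else 0#))
        ≈⟨ sumOver-swap (subsets n) Is _ ⟩
      sumOver Is (λ I → Pr-subset D (λ L → does (I ⊆? L)))
        ≤⟨ sumOver-≤-const small ⟩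
      fromℕ (length Is) * q ∎
      where
      open ≤-Reasoning
      W : Subset n → Subset n → ℝ
      W L I = if does (I ⊆? L) then weight D L else 0#
      0≤W : ∀ L I → 0# ≤ W L I
      0≤W L I = if-nonneg (does (I ⊆? L)) (weight-≥0 D L)
      single : ∀ L {I} {Js} → I ∈ Js → I ⊆ L → weight D L ≤ sumOver Js (W L)
      single L {I} {Js = _ ∷ Js} (here ≡.refl) I⊆L rewrite dec-true (I ⊆? L) I⊆L =
        x≤x+y (weight D L) (sumOver-nonneg Js (0≤W L))
      single L {Js = J ∷ Js} (there I∈) I⊆L = ≤-trans (single L I∈ I⊆L)
        (≤-trans (x≤x+y _ (0≤W L J)) (≤-reflexive (+-comm _ (W L J))))
      pointwise : ∀ L → (if E L then weight D L else 0#) ≤ sumOver Is (W L)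
      pointwise L with E L | cover L
      ... | false | _ = sumOver-nonneg Is (0≤W L)
      ... | true  | c = let (I , I∈ , I⊆L) = c tt in single L I∈ I⊆L

    restriction-bound : (B : Subset n → Bool) (E : (L : Subset n) → Cube (∁ L) → Bool) (ε : ℝ) → 0# ≤ ε →
                        (∀ L → Pr-uniform (E L) ≤ ε) →
                        1# ≤ Pr-restriction D (λ ρ → not (B (live ρ)) ∧ not (E (live ρ) (fixed ρ))) + Pr-subset D B + ε
    restriction-bound B E ε 0≤ε small = begin
      1#
        ≈⟨ weight-∑1 D ⟨
      sumOver (subsets n) (weight D)
        ≤⟨ sumOver-mono (subsets n) pointwise ⟩
      sumOver (subsets n) (λ L → weight D L * P L + Z L + weight D L * ε)
        ≈⟨ trans (sumOver-+ (subsets n) _ _) (+-cong (sumOver-+ (subsets n) _ _)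
             (trans (sumOver-*ʳ (subsets n) (weight D) ε) (trans (*-congʳ (weight-∑1 D)) (*-identityˡ ε)))) ⟩
      Pr-restriction D (λ ρ → not (B (live ρ)) ∧ not (E (live ρ) (fixed ρ))) + Pr-subset D B + ε ∎
      where
      open ≤-Reasoning
      P Z : Subset n → ℝ
      P L = Pr-uniform (λ x → not (B L) ∧ not (E L x))
      Z L = if B L then weight D L else 0#
      pointwise : ∀ L → weight D L ≤ weight D L * P L + Z L + weight D L * ε
      pointwise L with B L
      ... | true  = ≤-trans (x≤x+y _ (*-nonneg (weight-≥0 D L) 0≤ε)) (+-monoˡ-≤ (weight D L * ε)
                      (≤-trans (x≤x+y _ (*-nonneg (weight-≥0 D L) (Pr-uniform-nonneg (∁ L) (const false)))) (≤-reflexive (+-comm _ _))))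
      ... | false = begin
        weight D L                                               ≈⟨ *-identityʳ _ ⟨
        weight D L * 1#                                          ≈⟨ *-congˡ (Pr-uniform-not (E L)) ⟨
        weight D L * (Pr-uniform (not ∘ E L) + Pr-uniform (E L)) ≤⟨ *-monoʳ-≤ (weight-≥0 D L) (+-monoʳ-≤ _ (small L)) ⟩
        weight D L * (Pr-uniform (not ∘ E L) + ε)                ≈⟨ distribˡ (weight D L) _ ε ⟩
        weight D L * Pr-uniform (not ∘ E L) + weight D L * ε     ≈⟨ +-congʳ (+-identityʳ _) ⟨
        weight D L * Pr-uniform (not ∘ E L) + 0# + weight D L * ε ∎

  -- 16 R = 1536 w³ m and m ≤ 3 log (1/ε); the square enters through p ^ h with 2h ≥ w.
  constant : ℝ
  constant = (fromℕ (1536 ℕ.* 3) ^ 2) ⁻¹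

  K>0 : 0# < fromℕ (1536 ℕ.* 3) ^ 2
  K>0 = ^-pos 2 (fromℕ-pos (1536 ℕ.* 3) (s≤s z≤n))

  0<constant : 0# < constant
  0<constant = ⁻¹-pos K>0

  constant<1 : constant < 1#
  constant<1 = ≤-trans (≤-reflexive (sym (*-identityˡ constant))) (x≤y*z⇒x/z≤y K>0 (≤-trans 1≤K (≤-reflexive (sym (*-identityˡ _))))) ,
    λ c≈1 → 1≰0 (≤-trans (≤-reflexive 1≈2-1) (x≤y+z⇒x-z≤y (≤-trans 2≤K
      (≤-reflexive (trans (trans (sym (*-identityʳ _)) (trans (*-congˡ (sym c≈1)) (⁻¹-inverseʳ K>0))) (sym (+-identityˡ 1#)))))))
    where
    1≤K : 1# ≤ fromℕ (1536 ℕ.* 3) ^ 2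
    1≤K = ≤-trans (fromℕ≥1 (ℕ.m^n>0 (1536 ℕ.* 3) 2)) (≤-reflexive (fromℕ-^ (1536 ℕ.* 3) 2))
    2≤K : 1# + 1# ≤ fromℕ (1536 ℕ.* 3) ^ 2
    2≤K = ≤-trans (≤-reflexive (+-congˡ (sym fromℕ-1))) (≤-trans (fromℕ-mono 2≤) (≤-reflexive (fromℕ-^ (1536 ℕ.* 3) 2)))
      where
      2≤ : 2 ℕ.≤ (1536 ℕ.* 3) ℕ.^ 2
      2≤ = s≤s (s≤s z≤n)
    1≈2-1 : 1# ≈ 1# + 1# - 1#
    1≈2-1 = sym (trans (+-assoc 1# 1# (- 1#)) (trans (+-congˡ (-‿inverseʳ 1#)) (+-identityʳ 1#)))

  module Main (δ ε s : ℝ) (w : ℕ) (0<δ : 0# < δ) (0<ε : 0# < ε) (ε≤½ : ε ≤ 1# / fromℕ 2)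
    (0<s : 0# < s) (s≤w : s ≤ fromℕ w) (p : ℝ) (p≤ : p ≤ threshold constant δ ε s w)
    (n : ℕ) (w≤n : w ℕ.≤ n) (f : DNF (Fin n)) (width : HasWidth w f) (D : Distribution n) (inClass : InClass p w D) where

    Approximable : Restriction n → Set
    Approximable ρ =
      Σ[ fℓ ∈ DNF (Elem (live ρ)) ] Σ[ fᵤ ∈ DNF (Elem (live ρ)) ]
        HasWidth ⌊ w /2⌋ fℓ × HasWidth ⌊ w /2⌋ fᵤ × IsSandwich ε ⟦ fℓ ⟧ᴸ (⟦ f ⟧ ↾ ρ) ⟦ fᵤ ⟧ᴸ

    0<w : 0 ℕ.< w
    0<w = positive w s≤w
      where
      positive : ∀ w → s ≤ fromℕ w → 0 ℕ.< w
      positive zero    s≤0 = ⊥-elim (proj₂ 0<s (antisym (proj₁ 0<s) s≤0))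
      positive (suc w) _   = s≤s z≤n

    0≤p : 0# ≤ p
    0≤p = ≤-trans (Pr-subset-nonneg D _) (≤-reflexive (InClass.regular inClass (Fin.fromℕ< (ℕ.<-≤-trans 0<w w≤n))))

    m : ℕ
    m = proj₁ (ceiling 0<ε ε≤½ n)

    isCeiling : Ceiling 0<ε ε≤½ n m
    isCeiling = proj₂ (ceiling 0<ε ε≤½ n)

    0<m : 0 ℕ.< m
    0<m = proj₁ isCeiling

    r spread h : ℕ
    r      = rounds w m
    spread = spreadness w m
    h      = suc ⌊ w /2⌋

    h≤w : h ℕ.≤ w
    h≤w = ⌊w/2⌋<w w 0<w

    w≤2h : w ℕ.≤ 2 ℕ.* h
    w≤2h = ℕ.≤-trans (w≤2⌊w/2⌋+1 w) (ℕ.≤-trans (ℕ.n≤1+n _) (ℕ.≤-reflexive (lem ⌊ w /2⌋)))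
      where
      lem : ∀ h → 1 ℕ.+ (1 ℕ.+ 2 ℕ.* h) ≡ 2 ℕ.* (1 ℕ.+ h)
      lem = solve-∀

    sw : Sandwich w r spread (toPartials f)
    sw = sandwich w r spread {{ℕ.>-nonZero (rounds>0 0<w 0<m)}} (2≤spreadness 0<w 0<m) ℕ.≤-refl
                  (toPartials f) (toPartials-size f width)
    open Sandwich sw

    terms : List (Partial n)
    terms = Fᵤ ++ Fℓ

    differ : Partial n → Bool
    differ H = hit Fᵤ H ∧ not (hit Fℓ H)

    err : {L : Subset n} → Cube (∁ L) → ℕ
    err {L} x = ∑ (points L) (λ y → ind (differ (complete (merge x y))))

    Bad : (L : Subset n) → Cube (∁ L) → Bool
    Bad L x = length (points L) ℕ.<ᵇ 2 ℕ.^ m ℕ.* err x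

    Wide : Subset n → Bool
    Wide = wide ⌊ w /2⌋ terms

    Pr-Bad≤ε : ∀ L → Pr-uniform (Bad L) ≤ ε
    Pr-Bad≤ε L = fraction-≤ε 0<ε ε≤½ isCeiling
      (ℕ.≤-trans (ℕ.≤-reflexive (cong (2 ℕ.^ m ℕ.*_) (length-filterᵇ (Bad L) (points (∁ L))))) (markov L differ m gap′))
      (points-nonempty (∁ L)) (length-points-≤ (∁ L))
      where
      gap′ : 2 ℕ.^ m ℕ.* (2 ℕ.^ m ℕ.* sumAbove 0 (∅ n) (ind ∘ differ)) ℕ.≤ mass 0 (∅ n)
      gap′ = ℕ.*-cancelˡ-≤ A {{A≢0}} (begin
        A ℕ.* (2 ℕ.^ m ℕ.* (2 ℕ.^ m ℕ.* G))    ≡⟨ lem A (2 ℕ.^ m) G ⟩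
        2 ℕ.^ m ℕ.* 2 ℕ.^ m ℕ.* A ℕ.* G        ≤⟨ ℕ.*-monoˡ-≤ G (enough-rounds 0<w 0<m) ⟩
        2 ℕ.^ r ℕ.* G                          ≤⟨ gap ⟩
        suc w ℕ.* (spread ℕ.^ w ℕ.* mass 0 (∅ n)) ≡⟨ ℕ.*-assoc (suc w) (spread ℕ.^ w) (mass 0 (∅ n)) ⟨
        A ℕ.* mass 0 (∅ n) ∎)
        where
        open ℕ.≤-Reasoning
        A = suc w ℕ.* spread ℕ.^ w
        G = sumAbove 0 (∅ n) (ind ∘ differ)
        A≢0 : NonZero A
        A≢0 = ℕ.m*n≢0 (suc w) (spread ℕ.^ w) {{_}} {{ℕ.m^n≢0 spread w {{ℕ.>-nonZero (ℕ.<-≤-trans (s≤s z≤n) (2≤spreadness 0<w 0<m))}}}}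
        lem : ∀ A t G → A ℕ.* (t ℕ.* (t ℕ.* G)) ≡ t ℕ.* t ℕ.* A ℕ.* G
        lem = solve-∀

    candidates : List (Subset n)
    candidates = concatMap (subsetsOfSize h) terms

    length-candidates : length candidates ℕ.≤ 2 ℕ.* (suc w ℕ.* spread ℕ.^ w) ℕ.* 2 ℕ.^ w
    length-candidates = begin
      length candidates
        ≡⟨ length-concatMap (subsetsOfSize h) terms ⟩
      ∑ terms (length ∘ subsetsOfSize h)
        ≤⟨ ∑-≤-const (All.map (λ {P} P≤w → ℕ.≤-trans (subsetsOfSize-length h P) (ℕ.^-monoʳ-≤ 2 P≤w)) (All.++⁺ narrowᵤ narrowℓ)) ⟩
      length terms ℕ.* 2 ℕ.^ w
        ≤⟨ ℕ.*-monoˡ-≤ (2 ℕ.^ w) (ℕ.≤-trans (ℕ.≤-reflexive (length-++ Fᵤ))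
             (ℕ.≤-trans (ℕ.+-mono-≤ lengthᵤ lengthℓ) (ℕ.≤-reflexive (cong (suc w ℕ.* spread ℕ.^ w ℕ.+_) (≡.sym (ℕ.+-identityʳ _)))))) ⟩
      2 ℕ.* (suc w ℕ.* spread ℕ.^ w) ℕ.* 2 ℕ.^ w ∎
      where open ℕ.≤-Reasoning

    Pr-Wide : Pr-subset D Wide ≤ fromℕ (2 ℕ.* length candidates) * p ^ h
    Pr-Wide = ≤-trans
      (union-bound D Wide candidates (fromℕ 2 * p ^ h) (wide-⊆ ⌊ w /2⌋ terms)
        (concat⁺ (map⁺ (All.universal (λ P → All.map (λ {I} → small {I}) (subsetsOfSize-size h P)) terms))))
      (≤-reflexive (trans (sym (*-assoc _ (fromℕ 2) (p ^ h)))
        (*-congʳ (trans (*-comm _ (fromℕ 2)) (sym (fromℕ-* 2 (length candidates)))))))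
      where
      small : ∀ {I} → ∣ I ∣ ≡ h → Pr-subset D (λ L → does (I ⊆? L)) ≤ fromℕ 2 * p ^ h
      small {I} e = subst (λ k → Pr-subset D (λ L → does (I ⊆? L)) ≤ fromℕ 2 * p ^ k) e
        (InClass.bounded inClass I (ℕ.≤-trans (ℕ.≤-reflexive e) h≤w))

    base : ℝ
    base = δ ** (s / (fromℕ 2 * fromℕ w))

    scaled-p : fromℕ (16 ℕ.* spread) ^ 2 * p ≤ base
    scaled-p = begin
      fromℕ (16 ℕ.* spread) ^ 2 * p                ≤⟨ *-monoˡ-≤ 0≤p (^-mono-≤ 2 (fromℕ-nonneg (16 ℕ.* spread)) spread≤) ⟩
      (K * q) ^ 2 * p                              ≈⟨ trans (*-congʳ (^-distrib-* K q 2)) (*-assoc _ _ p) ⟩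
      K ^ 2 * (q ^ 2 * p)                          ≤⟨ *-monoʳ-≤ (proj₁ K>0) (≤-trans (≤-reflexive (*-comm _ p)) (x≤y/z⇒x*z≤y 0<q² p≤)) ⟩
      K ^ 2 * (constant * base)                    ≈⟨ *-assoc _ constant base ⟨
      K ^ 2 * constant * base                      ≈⟨ *-congʳ (⁻¹-inverseʳ K>0) ⟩
      1# * base                                    ≈⟨ *-identityˡ base ⟩
      base                                         ∎
      where
      open ≤-Reasoning
      l = log (1# / ε)
      K = fromℕ (1536 ℕ.* 3)
      q = fromℕ w ^ 3 * l
      0<q² : 0# < q ^ 2
      0<q² = ^-pos 2 (*-pos (^-pos 3 (fromℕ-pos w 0<w)) (0<log 0<ε ε≤½))
      lem : ∀ w m → 16 ℕ.* (6 ℕ.* (16 ℕ.* (w ℕ.* w ℕ.* m) ℕ.* w)) ≡ 1536 ℕ.* (w ℕ.* (w ℕ.* (w ℕ.* 1)) ℕ.* m)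
      lem = solve-∀
      spread≤ : fromℕ (16 ℕ.* spread) ≤ K * q
      spread≤ = begin
        fromℕ (16 ℕ.* spread)                      ≈⟨ fromℕ-cong (lem w m) ⟩
        fromℕ (1536 ℕ.* (w ℕ.^ 3 ℕ.* m))           ≈⟨ trans (fromℕ-* 1536 (w ℕ.^ 3 ℕ.* m)) (*-congˡ (trans (fromℕ-* (w ℕ.^ 3) m) (*-congʳ (fromℕ-^ w 3)))) ⟩
        fromℕ 1536 * (fromℕ w ^ 3 * fromℕ m)       ≤⟨ *-monoʳ-≤ (fromℕ-nonneg 1536) (*-monoʳ-≤ (^-nonneg 3 (fromℕ-nonneg w))
                                                        (fromℕ-≤3log 0<ε ε≤½ m (proj₁ (proj₂ isCeiling)))) ⟩
        fromℕ 1536 * (fromℕ w ^ 3 * (fromℕ 3 * l)) ≈⟨ solve 4 (λ a b c d → a :* (b :* (c :* d)) := (a :* c) :* (b :* d)) refl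
                                                        (fromℕ 1536) (fromℕ w ^ 3) (fromℕ 3) l ⟩
        fromℕ 1536 * fromℕ 3 * q                   ≈⟨ *-congʳ (sym (fromℕ-* 1536 3)) ⟩
        K * q                                      ∎
        where open Solver

    Pr-Wide≤ : Pr-subset D Wide ≤ base ^ h
    Pr-Wide≤ = begin
      Pr-subset D Wide
        ≤⟨ Pr-Wide ⟩
      fromℕ (2 ℕ.* length candidates) * p ^ h
        ≤⟨ *-monoˡ-≤ (^-nonneg h 0≤p) (fromℕ-mono (few-subsets spread h (length candidates) 0<w
             (ℕ.<-≤-trans (s≤s z≤n) (2≤spreadness 0<w 0<m)) w≤2h length-candidates)) ⟩
      fromℕ (((16 ℕ.* spread) ℕ.^ 2) ℕ.^ h) * p ^ h
        ≈⟨ *-congʳ (trans (fromℕ-^ ((16 ℕ.* spread) ℕ.^ 2) h) (^-congˡ h (fromℕ-^ (16 ℕ.* spread) 2))) ⟩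
      (fromℕ (16 ℕ.* spread) ^ 2) ^ h * p ^ h
        ≈⟨ ^-distrib-* _ p h ⟨
      (fromℕ (16 ℕ.* spread) ^ 2 * p) ^ h
        ≤⟨ ^-mono-≤ h (*-nonneg (^-nonneg 2 (fromℕ-nonneg (16 ℕ.* spread))) 0≤p) scaled-p ⟩
      base ^ h ∎
      where open ≤-Reasoning

    event : Restriction n → Bool
    event ρ = not (Wide (live ρ)) ∧ not (Bad (live ρ) (fixed ρ))

    T-not : ∀ {b} → T (not b) → b ≡ false
    T-not {false} _ = ≡.refl

    event⇒approximable : ∀ ρ → T (event ρ) → Approximable ρ
    event⇒approximable ρ@(ρ[ L , x ]) t = restrictAll x Fℓ , restrictAll x Fᵤ ,
      restrictAll-width x ⌊ w /2⌋ Fℓ (∨-falseʳ not-wide) , restrictAll-width x ⌊ w /2⌋ Fᵤ (∨-falseˡ not-wide) ,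
      record
        { lower       = λ y → T⇒≤ (lower′ y)
        ; upper       = λ y → T⇒≤ (upper′ y)
        ; lower-error = error≤ε _ λ y → ℕ.≤-trans (ind-xorˡ {b = (⟦ f ⟧ ↾ ρ) y} (lower′ y) (upper′ y)) (ℕ.≤-reflexive (differ≡ y))
        ; upper-error = error≤ε _ λ y → ℕ.≤-trans (ind-xorʳ {b = (⟦ f ⟧ ↾ ρ) y} (lower′ y) (upper′ y)) (ℕ.≤-reflexive (differ≡ y))
        }
      where
      ∨-falseˡ : ∀ {a b} → a ∨ b ≡ false → a ≡ false
      ∨-falseˡ {false} _ = ≡.refl
      ∨-falseʳ : ∀ {a b} → a ∨ b ≡ false → b ≡ false
      ∨-falseʳ {false} e = e
      not-wide : wide ⌊ w /2⌋ Fᵤ L ∨ wide ⌊ w /2⌋ Fℓ L ≡ false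
      not-wide = ≡.trans (≡.sym (any-++ _ Fᵤ Fℓ)) (T-not (proj₁ (T-∧⁻ {not (Wide L)} t)))
      not-bad : 2 ℕ.^ m ℕ.* err x ℕ.≤ length (points L)
      not-bad = ℕ.≮⇒≥ λ l → subst T (T-not (proj₂ (T-∧⁻ {not (Wide L)} t))) (ℕ.<⇒<ᵇ l)
      f≡ : ∀ y → hit (toPartials f) (complete (merge x y)) ≡ (⟦ f ⟧ ↾ ρ) y
      f≡ y = hit-toPartials f (merge x y)
      lower′ : ∀ y → T (⟦ restrictAll x Fℓ ⟧ᴸ y) → T ((⟦ f ⟧ ↾ ρ) y)
      lower′ y u = subst T (f≡ y) (lower _ (subst T (restrictAll-eval x y Fℓ) u))
      upper′ : ∀ y → T ((⟦ f ⟧ ↾ ρ) y) → T (⟦ restrictAll x Fᵤ ⟧ᴸ y)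
      upper′ y u = subst T (≡.sym (restrictAll-eval x y Fᵤ)) (upper _ (subst T (≡.sym (f≡ y)) u))
      differ≡ : ∀ y → ind (⟦ restrictAll x Fᵤ ⟧ᴸ y ∧ not (⟦ restrictAll x Fℓ ⟧ᴸ y)) ≡ ind (differ (complete (merge x y)))
      differ≡ y = cong₂ (λ a b → ind (a ∧ not b)) (restrictAll-eval x y Fᵤ) (restrictAll-eval x y Fℓ)
      error≤ε : (E : Cube L → Bool) → (∀ y → ind (E y) ℕ.≤ ind (differ (complete (merge x y)))) → Pr-uniform E ≤ ε
      error≤ε E E≤ = fraction-≤ε 0<ε ε≤½ isCeiling
        (ℕ.≤-trans (ℕ.*-monoʳ-≤ (2 ℕ.^ m) (ℕ.≤-trans (ℕ.≤-reflexive (length-filterᵇ E (points L))) (∑-mono (points L) E≤))) not-bad)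
        (points-nonempty L) (length-points-≤ L)

    claim : WithProbability≥ (1# - δ ** (s / fromℕ 4) - ε) D Approximable
    claim with total 0# (log δ)
    ... | inj₁ 0≤l = const false , (λ _ ()) ,
      ≤-trans (x≤y+z⇒x-z≤y (x≤y+z⇒x-z≤y (≤-trans (1≤**-of-log≥0 0<s 0<w 0≤l)
        (≤-trans (x≤x+y _ (proj₁ 0<ε)) (≤-reflexive (trans (+-comm _ ε) (+-congʳ (sym (+-identityˡ ε)))))))))
        (Pr-restriction-nonneg D _)
    ... | inj₂ l≤0 = event , event⇒approximable ,
      x≤y+z⇒x-z≤y (x≤y+z⇒x-z≤y (begin
        1#
          ≤⟨ restriction-bound D Wide Bad ε (proj₁ 0<ε) Pr-Bad≤ε ⟩
        Pr-restriction D event + Pr-subset D Wide + ε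
          ≤⟨ +-monoˡ-≤ ε (+-monoʳ-≤ _ (≤-trans Pr-Wide≤ (**-^-≤ 0<s 0<w l≤0 h w≤2h))) ⟩
        Pr-restriction D event + δ ** (s / fromℕ 4) + ε
          ≈⟨ trans (+-assoc _ _ ε) (trans (+-congˡ (+-comm _ ε)) (sym (+-assoc _ ε _))) ⟩
        Pr-restriction D event + ε + δ ** (s / fromℕ 4) ∎))
      where open ≤-Reasoning

claim5p4 : (R : Reals) → let open Reals R in let open Probability R in
    Σ[ c ∈ ℝ ] 0# < c × c < 1# ×
    (∀ (δ ε s : ℝ) (w : ℕ) →
    0# < δ →
    0# < ε → ε ≤ 1# / fromℕ 2 →
    0# < s → s ≤ fromℕ w →
    ∀ (p : ℝ) → p ≤ threshold c δ ε s w →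
    ∀ (n : ℕ) → w ℕ.≤ n →
    ∀ (f : DNF (Fin n)) → HasWidth w f →
    ∀ (D : Distribution n) → InClass p w D →
    WithProbability≥ (1# - δ ** (s / fromℕ 4) - ε) D (λ ρ →
    Σ[ fℓ ∈ DNF (Elem (live ρ)) ] Σ[ fᵤ ∈ DNF (Elem (live ρ)) ]
    HasWidth ⌊ w /2⌋ fℓ × HasWidth ⌊ w /2⌋ fᵤ ×
    IsSandwich ε ⟦ fℓ ⟧ᴸ (⟦ f ⟧ ↾ ρ) ⟦ fᵤ ⟧ᴸ))
claim5p4 R = constant , 0<constant , constant<1 ,
  λ δ ε s w 0<δ 0<ε ε≤½ 0<s s≤w p p≤ n w≤n f width D inClass →
    Main.claim δ ε s w 0<δ 0<ε ε≤½ 0<s s≤w p p≤ n w≤n f width D inClass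
  where open Proof R
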